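{- Let $H(x,y)=\sum_{n\ge1}\sum_{\sigma\in S_n(T_1)}x^ny^{\sigma(1)}$. Then $$H(x,y)=\frac{xy\left[(xy-1)^2(1-y)\sqrt{1-4x}+x(1-2xy)\right]}{(1-y+xy^2)(1-2xy)\sqrt{1-4x}}.$$
   Context: A permutation $\sigma$ avoids $\tau$ if no subsequence of $\sigma$ has the same relative order as $\tau$. $T_1=\{3214,3241,4213,4231\}$ and $S_n(T_1)$ is the set of permutations in $S_n$ avoiding all four patterns. -}

module Defs where

open import Data.Bool using (Bool; true; false; not; _∧_; _xor_; if_then_else_)
open import Data.Nat as ℕ using (ℕ; zero; suc; _≡ᵇ_; _<ᵇ_; _∸_)
open import Data.List using (List; []; _∷_; [_]; map; _++_; concatMap; length; zipWith; applyUpTo; upTo)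
open import Data.Bool.ListAction using (any; and)
open import Data.Product using (_×_; _,_; proj₁; proj₂)
open import Data.Integer as ℤ using (ℤ; +_)
open import Relation.Binary.PropositionalEquality using (_≡_)

-- Permutations and pattern avoidance (one-line notation, values 1..n)

subseqs : {A : Set} → ℕ → List A → List (List A)
subseqs zero    _        = [ [] ]
subseqs (suc k) []       = []
subseqs (suc k) (a ∷ as) = map (a ∷_) (subseqs k as) ++ subseqs (suc k) as

pairs : {A : Set} → List A → List (A × A)
pairs []       = []
pairs (a ∷ as) = map (a ,_) as ++ pairs as

-- u and v have the same relative order (entries assumed distinct)
sameOrder : List ℕ → List ℕ → Bool
sameOrder u v =
  (length u ≡ᵇ length v) ∧
  and (zipWith (λ p q → not ((proj₁ p <ᵇ proj₂ p) xor (proj₁ q <ᵇ proj₂ q)))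
               (pairs u) (pairs v))

contains : List ℕ → List ℕ → Bool
contains σ τ = any (λ s → sameOrder s τ) (subseqs (length τ) σ)

T₁ : List (List ℕ)
T₁ = (3 ∷ 2 ∷ 1 ∷ 4 ∷ []) ∷ (3 ∷ 2 ∷ 4 ∷ 1 ∷ []) ∷
     (4 ∷ 2 ∷ 1 ∷ 3 ∷ []) ∷ (4 ∷ 2 ∷ 3 ∷ 1 ∷ []) ∷ []

avoidsT₁ : List ℕ → Bool
avoidsT₁ σ = not (any (contains σ) T₁)

words : ℕ → ℕ → List (List ℕ)
words n zero    = [ [] ]
words n (suc k) = concatMap (λ w → map (_∷ w) (applyUpTo suc n)) (words n k)

distinct : List ℕ → Bool
distinct []       = true
distinct (a ∷ as) = not (any (a ≡ᵇ_) as) ∧ distinct as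

filterᵇ : {A : Set} → (A → Bool) → List A → List A
filterᵇ p []       = []
filterᵇ p (a ∷ as) = if p a then a ∷ filterᵇ p as else filterᵇ p as

S : ℕ → List (List ℕ)
S n = filterᵇ distinct (words n n)

firstIs : ℕ → List ℕ → Bool
firstIs k []      = false
firstIs k (a ∷ _) = a ≡ᵇ k

h : ℕ → ℕ → ℕ
h zero    k = 0
h (suc n) k = length (filterᵇ (λ σ → avoidsT₁ σ ∧ firstIs k σ) (S (suc n)))

-- Formal power series in x, y over ℤ:  f i j = coefficient of x^i y^j

PS : Set
PS = ℕ → ℕ → ℤ

_≈ₚ_ : PS → PS → Set
f ≈ₚ g = ∀ i j → f i j ≡ g i j

infixl 6 _+ₚ_ _-ₚ_
infixl 7 _*ₚ_

sumℤ : List ℤ → ℤ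
sumℤ []       = + 0
sumℤ (a ∷ as) = a ℤ.+ sumℤ as

_+ₚ_ : PS → PS → PS
(f +ₚ g) i j = f i j ℤ.+ g i j

_-ₚ_ : PS → PS → PS
(f -ₚ g) i j = f i j ℤ.- g i j

_*ₚ_ : PS → PS → PS
(f *ₚ g) i j =
  sumℤ (map (λ a → sumℤ (map (λ b → f a b ℤ.* g (i ∸ a) (j ∸ b))
                             (upTo (suc j))))
            (upTo (suc i)))

mono : ℤ → ℕ → ℕ → PS
mono c m n i j = if (i ≡ᵇ m) ∧ (j ≡ᵇ n) then c else + 0

oneₚ xₚ yₚ : PS
oneₚ = mono (+ 1) 0 0
xₚ   = mono (+ 1) 1 0
yₚ   = mono (+ 1) 0 1

H : PS
H i j = + h i j

private
  open import Relation.Binary.PropositionalEquality using (refl)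
  _ : h 4 3 ≡ 4
  _ = refl
  _ : length (filterᵇ avoidsT₁ (S 4)) ≡ 20
  _ = refl

{-# OPTIONS --safe #-}

-- σ avoids T₁ exactly when every entry that is not a left-to-right maximum is the least or the
-- greatest of the entries from there on. So the number f l r of ways to complete a good prefix
-- depends only on the numbers l and r of unused values below and above its maximum, and σ(1) = k
-- leaves l = k − 1, r = n − k. The recurrence f (l + 1) (r + 2) = f l (r + 2) + f (l + 2) (r + 1)
-- is multiplication of H by the kernel 1 − y + x y². On its boundary lie powers of 2, with series
-- in 1/(1 − 2xy), and f 0 (r + 1) = C(2r, r), whose series B is 1/√(1 − 4x): the differential
-- equation of B² gives B² (1 − 4x) = 1, so (B s)² = 1 for every square root s of 1 − 4x, and
-- B s = 1 if s has constant term 1.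
module Submission where

open import Defs
open import Algebra.Bundles using (CommutativeRing)
import Algebra.Construct.Pointwise as Pointwise
import Algebra.Properties.CommutativeSemigroup as CommutativeSemigroupProperties
import Algebra.Properties.Ring as RingProperties
import Algebra.Solver.Ring.NaturalCoefficients.Default as NaturalSolver
open import Data.Nat using (ℕ; zero; suc)
open import Data.Product using (_×_; _,_; proj₁; proj₂; uncurry; map₂)
open import Function using (_∘_; Equivalence)
open import Level using (Level)
import Relation.Binary.Reasoning.Setoid as SetoidReasoning

-- The kernel vanishes at y = (1 - √(1 - 4x))/(2x), and the usual kernel method would substitute
-- this root to find the unknown boundary series. No substitution occurs here: f 0 (r + 1) is found
-- in closed form. Since the recurrence lowers r only by raising l, this takes a formula for all l,
-- namely f l (r + 1) = Σ C(2r + l, r + i) over 0 ≤ i ≤ l. The kernel equation then reads H (1 - y +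
-- x y²) = xy (1 - y) + x² y B + x³ y³ (1 - y)/(1 - 2xy). Its three terms come from the permutation
-- of length 1, from first value 1, and from the boundary values f l 0 and f l 1. A second obstacle
-- is that `_*ₚ_` is a nested finite sum, in which ring laws are hard to see; they are proved for an
-- iterated one-variable product and carried over.

module _ {c ℓ : Level} (R : CommutativeRing c ℓ) where
  open CommutativeRing R

  -- The two products agree only up to `_≈_`, so each law is transported along `·≈*`. With `_·_`
  -- itself as the product of the new ring, identities proved there are literally statements about
  -- `_*ₚ_`.
  withMultiplication : (_·_ : Carrier → Carrier → Carrier) (1′ : Carrier) →
    (∀ x y → x · y ≈ x * y) → 1′ ≈ 1# → CommutativeRing c ℓ
  withMultiplication _·_ 1′ ·≈* 1′≈1 = record
    { Carrier = Carrier
    ; _≈_ = _≈_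
    ; _+_ = _+_
    ; _*_ = _·_
    ; -_ = -_
    ; 0# = 0#
    ; 1# = 1′
    ; isCommutativeRing = record
      { isRing = record
        { +-isAbelianGroup = +-isAbelianGroup
        ; *-cong = λ p q → via (*-cong p q)
        ; *-assoc = λ x y z → via (trans (*-congʳ (·≈* x y)) (trans (*-assoc x y z) (*-congˡ (sym (·≈* y z)))))
        ; *-identity = identityˡ , λ x → trans (via (*-comm x 1′)) (identityˡ x)
        ; distrib = (λ x y z → trans (·≈* x (y + z)) (trans (distribˡ x y z) (sym (+-cong (·≈* x y) (·≈* x z)))))
                  , (λ x y z → trans (·≈* (y + z) x) (trans (distribʳ x y z) (sym (+-cong (·≈* y x) (·≈* z x)))))
        }
      ; *-comm = λ x y → via (*-comm x y)
      }
    }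
    where
    via : ∀ {x y u v} → x * y ≈ u * v → x · y ≈ u · v
    via {x} {y} {u} {v} p = trans (·≈* x y) (trans p (sym (·≈* u v)))
    identityˡ : ∀ x → 1′ · x ≈ x
    identityˡ x = trans (·≈* 1′ x) (trans (*-congʳ 1′≈1) (*-identityˡ x))

-- Formal power series over a commutative ring

module PowerSeries {c ℓ : Level} (R : CommutativeRing c ℓ) where
  open CommutativeRing R
  open CommutativeSemigroupProperties +-commutativeSemigroup using (interchange; x∙yz≈y∙xz)
  open SetoidReasoning setoid

  Series : Set c
  Series = ℕ → Carrier

  infix 4 _≋_
  _≋_ : Series → Series → Set ℓ
  f ≋ g = ∀ n → f n ≈ g n

  infixl 6 _⊕_
  _⊕_ : Series → Series → Series
  (f ⊕ g) n = f n + g n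

  -- Recursion on the tail of the first factor: f = f₀ + t · (f ∘ suc).
  infixl 7 _⊛_
  _⊛_ : Series → Series → Series
  (f ⊛ g) zero    = f 0 * g 0
  (f ⊛ g) (suc n) = f 0 * g (suc n) + ((f ∘ suc) ⊛ g) n

  const : Carrier → Series
  const a zero    = a
  const a (suc n) = 0#

  shift : Series → Series
  shift f zero    = 0#
  shift f (suc n) = f n

  ⊛-cong : ∀ {f f′ g g′} → f ≋ f′ → g ≋ g′ → f ⊛ g ≋ f′ ⊛ g′
  ⊛-cong p q zero    = *-cong (p 0) (q 0)
  ⊛-cong p q (suc n) = +-cong (*-cong (p 0) (q (suc n))) (⊛-cong (p ∘ suc) q n)

  ⊛-distribʳ : ∀ h f g → (f ⊕ g) ⊛ h ≋ f ⊛ h ⊕ g ⊛ h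
  ⊛-distribʳ h f g zero    = distribʳ _ _ _
  ⊛-distribʳ h f g (suc n) =
    trans (+-cong (distribʳ _ _ _) (⊛-distribʳ h (f ∘ suc) (g ∘ suc) n)) (interchange _ _ _ _)

  ⊛-zeroˡ : ∀ g n → ((λ _ → 0#) ⊛ g) n ≈ 0#
  ⊛-zeroˡ g zero    = zeroˡ _
  ⊛-zeroˡ g (suc n) = trans (+-cong (zeroˡ _) (⊛-zeroˡ g n)) (+-identityˡ _)

  const-⊛ : ∀ a g n → (const a ⊛ g) n ≈ a * g n
  const-⊛ a g zero    = refl
  const-⊛ a g (suc n) = trans (+-congˡ (⊛-zeroˡ g n)) (+-identityʳ _)

  shift-⊛ : ∀ f g → shift f ⊛ g ≋ shift (f ⊛ g)
  shift-⊛ f g zero    = zeroˡ _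
  shift-⊛ f g (suc n) = trans (+-congʳ (zeroˡ _)) (+-identityˡ _)

  scale-⊛ : ∀ a f g n → ((λ i → a * f i) ⊛ g) n ≈ a * (f ⊛ g) n
  scale-⊛ a f g zero    = *-assoc _ _ _
  scale-⊛ a f g (suc n) =
    trans (+-cong (*-assoc _ _ _) (scale-⊛ a (f ∘ suc) g n)) (sym (distribˡ _ _ _))

  -- By definition the tail of `f ⊛ g` is `f 0` times the tail of `g` plus the product of the tail
  -- of `f` with `g`. Distributivity separates the two, and only the second needs the induction
  -- hypothesis.
  ⊛-assoc : ∀ f g h → (f ⊛ g) ⊛ h ≋ f ⊛ (g ⊛ h)
  ⊛-assoc f g h zero    = *-assoc _ _ _
  ⊛-assoc f g h (suc n) = begin
    f 0 * g 0 * h (suc n) + (((λ i → f 0 * g (suc i)) ⊕ (f ∘ suc) ⊛ g) ⊛ h) n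
      ≈⟨ +-cong (*-assoc _ _ _) (⊛-distribʳ h _ _ n) ⟩
    f 0 * (g 0 * h (suc n)) + (((λ i → f 0 * g (suc i)) ⊛ h) n + (((f ∘ suc) ⊛ g) ⊛ h) n)
      ≈⟨ +-congˡ (+-cong (scale-⊛ (f 0) (g ∘ suc) h n) (⊛-assoc (f ∘ suc) g h n)) ⟩
    f 0 * (g 0 * h (suc n)) + (f 0 * ((g ∘ suc) ⊛ h) n + ((f ∘ suc) ⊛ (g ⊛ h)) n)
      ≈⟨ +-assoc _ _ _ ⟨
    f 0 * (g 0 * h (suc n)) + f 0 * ((g ∘ suc) ⊛ h) n + ((f ∘ suc) ⊛ (g ⊛ h)) n
      ≈⟨ +-congʳ (distribˡ _ _ _) ⟨
    f 0 * (g 0 * h (suc n) + ((g ∘ suc) ⊛ h) n) + ((f ∘ suc) ⊛ (g ⊛ h)) n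
      ∎

  -- The mirror image of the defining clause, splitting off the constant term of the second factor;
  -- commutativity follows by comparing the two.
  ⊛-suc : ∀ f g n → (f ⊛ g) (suc n) ≈ g 0 * f (suc n) + (f ⊛ (g ∘ suc)) n
  ⊛-suc f g zero    = trans (+-comm _ _) (+-congʳ (*-comm _ _))
  ⊛-suc f g (suc n) = begin
    f 0 * g (suc (suc n)) + ((f ∘ suc) ⊛ g) (suc n)
      ≈⟨ +-congˡ (⊛-suc (f ∘ suc) g n) ⟩
    f 0 * g (suc (suc n)) + (g 0 * f (suc (suc n)) + ((f ∘ suc) ⊛ (g ∘ suc)) n)
      ≈⟨ x∙yz≈y∙xz _ _ _ ⟩
    g 0 * f (suc (suc n)) + (f 0 * g (suc (suc n)) + ((f ∘ suc) ⊛ (g ∘ suc)) n)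
      ∎

  ⊛-comm : ∀ f g → f ⊛ g ≋ g ⊛ f
  ⊛-comm f g zero    = *-comm _ _
  ⊛-comm f g (suc n) = trans (⊛-suc f g n) (+-congˡ (⊛-comm f (g ∘ suc) n))

  commutativeRing : CommutativeRing c ℓ
  commutativeRing = record
    { Carrier = Series
    ; _≈_ = _≋_
    ; _+_ = _⊕_
    ; _*_ = _⊛_
    ; -_ = λ f n → - f n
    ; 0# = λ _ → 0#
    ; 1# = const 1#
    ; isCommutativeRing = record
      { isRing = record
        { +-isAbelianGroup = Pointwise.isAbelianGroup ℕ +-isAbelianGroup
        ; *-cong = ⊛-cong
        ; *-assoc = ⊛-assoc
        ; *-identity = identityˡ , λ f n → trans (⊛-comm f _ n) (identityˡ f n)
        ; distrib = (λ f g h n → trans (⊛-comm f _ n)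
                                (trans (⊛-distribʳ f g h n) (+-cong (⊛-comm g f n) (⊛-comm h f n))))
                  , ⊛-distribʳ
        }
      ; *-comm = ⊛-comm
      }
    }
    where
    identityˡ : ∀ f → const 1# ⊛ f ≋ f
    identityˡ f n = trans (const-⊛ 1# f n) (*-identityˡ (f n))

  -- The constant term `f 0 * g 0` forces `f 0` to vanish, and then the tail of `f` satisfies the
  -- same hypothesis. Cancellation by `g 0` is assumed in the shape of the conclusion, so that the
  -- lemma can feed itself when the coefficients are again series.
  regular : ∀ {g} → (∀ a → a * g 0 ≈ 0# → a ≈ 0#) →
            ∀ f → (∀ n → (f ⊛ g) n ≈ 0#) → ∀ n → f n ≈ 0#
  regular         reg f fg≈0 zero    = reg (f 0) (fg≈0 0)
  regular {g = g} reg f fg≈0 (suc n) = regular reg (f ∘ suc) tail≈0 n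
    where
    tail≈0 : ∀ n → ((f ∘ suc) ⊛ g) n ≈ 0#
    tail≈0 n = begin
      ((f ∘ suc) ⊛ g) n                       ≈⟨ +-identityˡ _ ⟨
      0# + ((f ∘ suc) ⊛ g) n                  ≈⟨ +-congʳ (zeroˡ _) ⟨
      0# * g (suc n) + ((f ∘ suc) ⊛ g) n      ≈⟨ +-congʳ (*-congʳ (reg (f 0) (fg≈0 0))) ⟨
      f 0 * g (suc n) + ((f ∘ suc) ⊛ g) n     ≈⟨ fg≈0 (suc n) ⟩
      0#                                      ∎

-- Identities in a commutative ring

module RingIdentities {c ℓ : Level} (R : CommutativeRing c ℓ) where
  open CommutativeRing R
  open RingProperties ring using (-1*x≈-x; -‿involutive)
  open SetoidReasoning setoid
  open NaturalSolver commutativeSemiring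

  involution-factor : ∀ u → u * u ≈ 1# → (u - 1#) * (u + 1#) ≈ 0#
  involution-factor u u²≈1 = begin
    -- The solver works in the underlying semiring, with `- 1#` as an opaque atom `n`; what is known
    -- of `n`, that `1# + n` vanishes, is applied afterwards.
    (u + n) * (u + 1#)       ≈⟨ solve 2 (λ u n → (u :+ n) :* (u :+ con 1) := u :* u :+ n :+ u :* (con 1 :+ n)) refl u n ⟩
    u * u + n + u * (1# + n) ≈⟨ +-cong (+-congʳ u²≈1) (*-congˡ (-‿inverseʳ 1#)) ⟩
    1# + n + u * 0#          ≈⟨ +-cong (-‿inverseʳ 1#) (zeroʳ u) ⟩
    0# + 0#                  ≈⟨ +-identityˡ 0# ⟩
    0#                       ∎
    where n = - 1#

  square-of-difference : ∀ w → (w - 1#) * (w - 1#) ≈ (1# - (w + w)) + w * w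
  square-of-difference w = begin
    (w + n) * (w + n)
      ≈⟨ +-identityʳ _ ⟨
    (w + n) * (w + n) + 0#
      -- The added `w + w` completes the cross term `w * n + w * n` to the vanishing
      -- `(w + w) * (1# + n)`.
      ≈⟨ +-congˡ (-‿inverseʳ (w + w)) ⟨
    (w + n) * (w + n) + ((w + w) + m)
      ≈⟨ solve 3 (λ w n m → (w :+ n) :* (w :+ n) :+ ((w :+ w) :+ m) :=
                            n :* n :+ m :+ w :* w :+ (w :+ w) :* (con 1 :+ n)) refl w n m ⟩
    n * n + m + w * w + (w + w) * (1# + n)
      ≈⟨ +-cong (+-congʳ (+-congʳ (trans (-1*x≈-x n) (-‿involutive 1#))))
                (trans (*-congˡ (-‿inverseʳ 1#)) (zeroʳ (w + w))) ⟩
    (1# + m) + w * w + 0#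
      ≈⟨ +-identityʳ _ ⟩
    (1# + m) + w * w ∎
    where
    n = - 1#
    m = - (w + w)

  -- Adding - y times a suitable term to both sides of the subtraction-free relation.
  kernel-relation : ∀ H V W y T G →
    H + V * H + W * y + G * y ≈ y * H + W + T + G →
    H * (1# - y + V) ≈ W * (1# - y) + T + G * (1# - y)
  kernel-relation H V W y T G e = begin
    H * (1# + n + V)
      ≈⟨ +-identityʳ _ ⟨
    H * (1# + n + V) + 0#
      ≈⟨ +-congˡ (absorb (W + G)) ⟨
    H * (1# + n + V) + (W + G) * (y + n)
      ≈⟨ solve 6 (λ H V W y n G → H :* (con 1 :+ n :+ V) :+ (W :+ G) :* (y :+ n) :=
                   (H :+ V :* H :+ W :* y :+ G :* y) :+ n :* (H :+ W :+ G)) refl H V W y n G ⟩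
    (H + V * H + W * y + G * y) + n * (H + W + G)
      ≈⟨ +-congʳ e ⟩
    (y * H + W + T + G) + n * (H + W + G)
      ≈⟨ solve 6 (λ H W y n G T → (y :* H :+ W :+ T :+ G) :+ n :* (H :+ W :+ G) :=
                   W :* (con 1 :+ n) :+ T :+ G :* (con 1 :+ n) :+ H :* (y :+ n)) refl H W y n G T ⟩
    W * (1# + n) + T + G * (1# + n) + H * (y + n)
      ≈⟨ +-congˡ (absorb H) ⟩
    W * (1# + n) + T + G * (1# + n) + 0#
      ≈⟨ +-identityʳ _ ⟩
    W * (1# + n) + T + G * (1# + n) ∎
    where
    n = - y
    absorb : ∀ z → z * (y + n) ≈ 0#
    absorb z = trans (*-congˡ (-‿inverseʳ y)) (zeroʳ z)

  -- The factor `L` clears the denominator of `G`, and `s` cancels `B`. The two terms containing `Y`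
  -- then combine to `L + W * W`, which is the origin of the square (xy - 1)² in the numerator.
  multiply-out : ∀ {H K L s W N Y x B G} →
    H * K ≈ W * Y + W * (x * B) + G * Y → G * L ≈ W * (W * W) → N * N ≈ L + W * W → B * s ≈ 1# →
    H * (K * L * s) ≈ W * (N * N * Y * s + x * L)
  multiply-out {H} {K} {L} {s} {W} {N} {Y} {x} {B} {G} HK GL NN Bs = begin
    H * (K * L * s)
      ≈⟨ solve 4 (λ H K L s → H :* (K :* L :* s) := H :* K :* (L :* s)) refl H K L s ⟩
    H * K * (L * s)
      ≈⟨ *-congʳ HK ⟩
    (W * Y + W * (x * B) + G * Y) * (L * s)
      ≈⟨ solve 7 (λ W Y x B G L s → (W :* Y :+ W :* (x :* B) :+ G :* Y) :* (L :* s) :=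
                    W :* Y :* L :* s :+ G :* L :* (Y :* s) :+ W :* x :* L :* (B :* s)) refl W Y x B G L s ⟩
    W * Y * L * s + G * L * (Y * s) + W * x * L * (B * s)
      ≈⟨ +-cong (+-congˡ (*-congʳ GL)) (*-congˡ Bs) ⟩
    W * Y * L * s + W * (W * W) * (Y * s) + W * x * L * 1#
      ≈⟨ solve 5 (λ W Y x L s → W :* Y :* L :* s :+ W :* (W :* W) :* (Y :* s) :+ W :* x :* L :* con 1 :=
                    W :* ((L :+ W :* W) :* Y :* s :+ x :* L)) refl W Y x L s ⟩
    W * ((L + W * W) * Y * s + x * L)
      ≈⟨ *-congˡ (+-congʳ (*-congʳ (*-congʳ NN))) ⟨
    W * (N * N * Y * s + x * L) ∎

open import Data.Bool using (Bool; true; false; not; _∧_; _∨_; _xor_; if_then_else_)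
open import Data.Bool.ListAction using (any; all; and)
open import Data.Bool.Properties
  using (∨-assoc; ∨-comm; ∨-identityʳ; ∨-zeroʳ; ∨-idem; ∨-abs-∧; ∧-assoc; ∧-zeroʳ; ∧-identityʳ; ∧-distribˡ-∨; T-≡; ¬-not)
import Data.Integer as ℤ
import Data.Integer.Properties as ℤ
import Data.Integer.Tactic.RingSolver as ℤ-Solver
open import Data.List using (List; []; _∷_; [_]; map; _++_; _∷ʳ_; concatMap; length; applyUpTo; upTo; zipWith)
open import Data.List.Properties
  using (map-cong; map-cong-local; map-∘; map-applyUpTo; map-upTo; ++-assoc; ++-identityʳ; ∷ʳ-++; ∷-injectiveʳ; length-++; length-applyUpTo)
open import Data.List.Relation.Binary.Permutation.Propositional using (_↭_; ↭-refl; ↭-trans; ↭-sym; prep; swap)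
import Data.List.Relation.Binary.Permutation.Propositional as ↭
open import Data.List.Relation.Binary.Permutation.Propositional.Properties using (↭-length)
open import Data.List.Relation.Unary.All using (All; []; _∷_)
import Data.List.Relation.Unary.All as All
import Data.List.Relation.Unary.All.Properties as All
open import Data.List.Relation.Unary.AllPairs using (AllPairs; []; _∷_)
import Data.List.Relation.Unary.AllPairs as AllPairs
import Data.List.Relation.Unary.AllPairs.Properties as AllPairs
open import Data.Nat
open import Data.Nat.Combinatorics using (_C_; nCk+nC[k+1]≡[n+1]C[k+1]; nCk≡nC[n∸k]; nCn≡1; nC1≡n; k>n⇒nCk≡0)
open import Data.Nat.ListAction using (sum)
open import Data.Nat.Properties
import Data.Nat.Tactic.RingSolver as ℕ-Solver
open import Relation.Binary.PropositionalEquality hiding ([_])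
open import Relation.Nullary using (contradiction)

open CommutativeSemigroupProperties +-commutativeSemigroup using (interchange; x∙yz≈y∙xz)
open ≡-Reasoning

-- The pattern condition

<ᵇ-true : ∀ m n → m < n → (m <ᵇ n) ≡ true
<ᵇ-true m n m<n = Equivalence.to T-≡ (<⇒<ᵇ m<n)

<ᵇ-false : ∀ m n → n ≤ m → (m <ᵇ n) ≡ false
<ᵇ-false m n n≤m = ¬-not λ e → ≤⇒≯ n≤m (<ᵇ⇒< m n (Equivalence.from T-≡ e))

<ᵇ-true⁻¹ : ∀ m n → (m <ᵇ n) ≡ true → m < n
<ᵇ-true⁻¹ m n e = <ᵇ⇒< m n (Equivalence.from T-≡ e)

<ᵇ-false⁻¹ : ∀ m n → (m <ᵇ n) ≡ false → n ≤ m
<ᵇ-false⁻¹ m n e = ≮⇒≥ λ m<n → contradiction (trans (sym e) (<ᵇ-true m n m<n)) λ ()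

⊔-<ᵇ : ∀ m n k → (m ⊔ n <ᵇ k) ≡ (m <ᵇ k) ∧ (n <ᵇ k)
⊔-<ᵇ m n k with m <ᵇ k in m<k | n <ᵇ k in n<k
... | false | _     = <ᵇ-false (m ⊔ n) k (≤-trans (<ᵇ-false⁻¹ m k m<k) (m≤m⊔n m n))
... | true  | false = <ᵇ-false (m ⊔ n) k (≤-trans (<ᵇ-false⁻¹ n k n<k) (m≤n⊔m m n))
... | true  | true  = <ᵇ-true (m ⊔ n) k (⊔-pres-<m (<ᵇ-true⁻¹ m k m<k) (<ᵇ-true⁻¹ n k n<k))

variable
  A B : Set

any-cong : ∀ {p q : A → Bool} → (∀ x → p x ≡ q x) → ∀ xs → any p xs ≡ any q xs
any-cong p≗q []       = refl
any-cong p≗q (x ∷ xs) = cong₂ _∨_ (p≗q x) (any-cong p≗q xs)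

any-++ : ∀ (p : A → Bool) xs ys → any p (xs ++ ys) ≡ any p xs ∨ any p ys
any-++ p []       ys = refl
any-++ p (x ∷ xs) ys = trans (cong (p x ∨_) (any-++ p xs ys)) (sym (∨-assoc (p x) _ _))

any-map : ∀ (p : A → Bool) (f : B → A) xs → any p (map f xs) ≡ any (p ∘ f) xs
any-map p f []       = refl
any-map p f (x ∷ xs) = cong (p (f x) ∨_) (any-map p f xs)

any-∨ : ∀ (p q : A → Bool) xs → any p xs ∨ any q xs ≡ any (λ x → p x ∨ q x) xs
any-∨ p q []       = refl
any-∨ p q (x ∷ xs) with p x | q x
... | true  | _     = refl
... | false | true  = ∨-zeroʳ _
... | false | false = any-∨ p q xs

any-↭ : ∀ (p : A → Bool) {xs ys} → xs ↭ ys → any p xs ≡ any p ys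
any-↭ p ↭.refl       = refl
any-↭ p (prep x r)   = cong (p x ∨_) (any-↭ p r)
any-↭ p (swap x y r) with p x | p y
... | true  | true  = refl
... | true  | false = refl
... | false | true  = refl
... | false | false = any-↭ p r
any-↭ p (↭.trans r r′) = trans (any-↭ p r) (any-↭ p r′)

-- The four patterns of T₁ together forbid an entry b having an entry a ≥ b to its left and, to its
-- right, two entries c and d on different sides of b.
forbidden : List ℕ → Bool
forbidden (a ∷ b ∷ c ∷ d ∷ []) = not (a <ᵇ b) ∧ ((b <ᵇ c) xor (b <ᵇ d))
forbidden _                    = false

matchesT₁ : List ℕ → Bool
matchesT₁ s = any (sameOrder s) T₁

-- A list of length four is seen by `sameOrder` only through its six comparisons. The hypotheses of
-- `table` are the instances of transitivity that exclude impossible rows; the remaining rows are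
-- computed. Equal entries count as not less on both sides, so the lemma holds for all lists.
matchesT₁≡forbidden : ∀ s → matchesT₁ s ≡ forbidden s
matchesT₁≡forbidden []                      = refl
matchesT₁≡forbidden (a ∷ [])                = refl
matchesT₁≡forbidden (a ∷ b ∷ [])            = refl
matchesT₁≡forbidden (a ∷ b ∷ c ∷ [])        = refl
matchesT₁≡forbidden (a ∷ b ∷ c ∷ d ∷ e ∷ s) = refl
matchesT₁≡forbidden (a ∷ b ∷ c ∷ d ∷ [])    =
  table (a <ᵇ b) (a <ᵇ c) (a <ᵇ d) (b <ᵇ c) (b <ᵇ d) (c <ᵇ d)
    (λ a≮b b≮c → <ᵇ-false a c (≤-trans (<ᵇ-false⁻¹ b c b≮c) (<ᵇ-false⁻¹ a b a≮b)))
    (λ a≮b b≮d → <ᵇ-false a d (≤-trans (<ᵇ-false⁻¹ b d b≮d) (<ᵇ-false⁻¹ a b a≮b)))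
    (λ b≮c b<d → <ᵇ-true c d (≤-<-trans (<ᵇ-false⁻¹ b c b≮c) (<ᵇ-true⁻¹ b d b<d)))
    (λ b<c b≮d → <ᵇ-false c d (≤-trans (<ᵇ-false⁻¹ b d b≮d) (<⇒≤ (<ᵇ-true⁻¹ b c b<c))))
  where
  agrees : List Bool → List ℕ → Bool
  agrees u τ = and (zipWith (λ x q → not (x xor (proj₁ q <ᵇ proj₂ q))) u (pairs τ))

  table : ∀ ab ac ad bc bd cd →
    (ab ≡ false → bc ≡ false → ac ≡ false) →
    (ab ≡ false → bd ≡ false → ad ≡ false) →
    (bc ≡ false → bd ≡ true → cd ≡ true) →
    (bc ≡ true → bd ≡ false → cd ≡ false) →
    any (agrees (ab ∷ ac ∷ ad ∷ bc ∷ bd ∷ cd ∷ [])) T₁ ≡ not ab ∧ (bc xor bd)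
  table true  _     _     _     _     _  _ _ _ _ = refl
  table false ac ad false true cd p q r s rewrite p refl refl | r refl refl with ad
  ... | true  = refl
  ... | false = refl
  table false ac ad true false cd p q r s rewrite q refl refl | s refl refl with ac
  ... | true  = refl
  ... | false = refl
  table false true  true  true  true  _ _ _ _ _ = refl
  table false true  false true  true  _ _ _ _ _ = refl
  table false false true  true  true  _ _ _ _ _ = refl
  table false false false true  true  _ _ _ _ _ = refl
  table false true  true  false false _ _ _ _ _ = refl
  table false true  false false false _ _ _ _ _ = refl
  table false false true  false false _ _ _ _ _ = refl
  table false false false false false _ _ _ _ _ = refl

-- All four patterns have length 4, so `contains` scans the same list of subsequences for each, and
-- the two disjunctions can be exchanged.
avoidsT₁≡ : ∀ σ → avoidsT₁ σ ≡ not (any forbidden (subseqs 4 σ))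
avoidsT₁≡ σ = cong not (trans (exchange T₁ refl) (any-cong matchesT₁≡forbidden (subseqs 4 σ)))
  where
  exchange : ∀ τs → all (λ τ → length τ ≡ᵇ 4) τs ≡ true →
             any (contains σ) τs ≡ any (λ s → any (sameOrder s) τs) (subseqs 4 σ)
  exchange []       _ = sym (any-false (subseqs 4 σ))
    where
    any-false : ∀ (xs : List A) → any (λ _ → false) xs ≡ false
    any-false []       = refl
    any-false (x ∷ xs) = any-false xs
  exchange ((_ ∷ _ ∷ _ ∷ _ ∷ []) ∷ τs) e = trans (cong (_ ∨_) (exchange τs e)) (any-∨ _ _ (subseqs 4 σ))

mixed : ℕ → List ℕ → Bool
mixed b w = any (b <ᵇ_) w ∧ any (λ c → not (b <ᵇ c)) w

-- The prefix before w enters only through its maximum M.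
bad : ℕ → List ℕ → Bool
bad M w = any (λ s → forbidden (M ∷ s)) (subseqs 3 w) ∨ any forbidden (subseqs 4 w)

any-forbidden₁ : ∀ a b c w →
  any (λ s → forbidden (a ∷ b ∷ c ∷ s)) (subseqs 1 w) ≡ not (a <ᵇ b) ∧ any (λ d → (b <ᵇ c) xor (b <ᵇ d)) w
any-forbidden₁ a b c []      = sym (∧-zeroʳ _)
any-forbidden₁ a b c (d ∷ w) = trans (cong (_ ∨_) (any-forbidden₁ a b c w)) (sym (∧-distribˡ-∨ (not (a <ᵇ b)) _ _))

any-forbidden₂ : ∀ a b w →
  any (λ s → forbidden (a ∷ b ∷ s)) (subseqs 2 w) ≡ not (a <ᵇ b) ∧ mixed b w
any-forbidden₂ a b []      = sym (∧-zeroʳ _)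
any-forbidden₂ a b (c ∷ w) = begin
  any f (map (c ∷_) (subseqs 1 w) ++ subseqs 2 w)
    ≡⟨ any-++ f (map (c ∷_) (subseqs 1 w)) (subseqs 2 w) ⟩
  any f (map (c ∷_) (subseqs 1 w)) ∨ any f (subseqs 2 w)
    ≡⟨ cong₂ _∨_ (trans (any-map f (c ∷_) (subseqs 1 w)) (any-forbidden₁ a b c w)) (any-forbidden₂ a b w) ⟩
  not (a <ᵇ b) ∧ any (λ d → (b <ᵇ c) xor (b <ᵇ d)) w ∨ not (a <ᵇ b) ∧ mixed b w
    ≡⟨ ∧-distribˡ-∨ (not (a <ᵇ b)) _ _ ⟨
  not (a <ᵇ b) ∧ (any (λ d → (b <ᵇ c) xor (b <ᵇ d)) w ∨ mixed b w)
    ≡⟨ cong (not (a <ᵇ b) ∧_) step ⟩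
  not (a <ᵇ b) ∧ mixed b (c ∷ w) ∎
  where
  f : List ℕ → Bool
  f s = forbidden (a ∷ b ∷ s)
  -- One entry of `w` on the side of `b` opposite to `c` settles the matter, so `mixed b w`, which
  -- also provides such an entry, is absorbed.
  step : any (λ d → (b <ᵇ c) xor (b <ᵇ d)) w ∨ mixed b w ≡ mixed b (c ∷ w)
  step with b <ᵇ c
  ... | true  = trans (∨-comm _ (mixed b w)) (∨-∧-absorb (any (b <ᵇ_) w) _)
    where
    ∨-∧-absorb : ∀ x y → x ∧ y ∨ y ≡ y
    ∨-∧-absorb true  true  = refl
    ∨-∧-absorb true  false = refl
    ∨-∧-absorb false y     = refl
  ... | false = trans (∨-abs-∧ (any (b <ᵇ_) w) _) (sym (∧-identityʳ _))

-- A forbidden subsequence uses `b` second, first, or not at all. Second place after `M` gives the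
-- `mixed` term. First place merges with first place for `M`: the first entry matters only by not
-- being less than the second, so the larger of `M` and `b` decides.
bad-∷ : ∀ M b w → bad M (b ∷ w) ≡ not (M <ᵇ b) ∧ mixed b w ∨ bad (M ⊔ b) w
bad-∷ M b w = begin
  any (f M) (map (b ∷_) (subseqs 2 w) ++ subseqs 3 w) ∨ any forbidden (map (b ∷_) (subseqs 3 w) ++ subseqs 4 w)
    ≡⟨ cong₂ _∨_ (any-++ (f M) (map (b ∷_) (subseqs 2 w)) _) (any-++ forbidden (map (b ∷_) (subseqs 3 w)) _) ⟩
  (any (f M) (map (b ∷_) (subseqs 2 w)) ∨ any (f M) (subseqs 3 w)) ∨
  (any forbidden (map (b ∷_) (subseqs 3 w)) ∨ rest)
    ≡⟨ cong₂ (λ u v → (u ∨ any (f M) (subseqs 3 w)) ∨ (v ∨ rest))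
         (trans (any-map (f M) (b ∷_) (subseqs 2 w)) (any-forbidden₂ M b w))
         (any-map forbidden (b ∷_) (subseqs 3 w)) ⟩
  (not (M <ᵇ b) ∧ mixed b w ∨ any (f M) (subseqs 3 w)) ∨ (any (f b) (subseqs 3 w) ∨ rest)
    ≡⟨ ∨-assoc (not (M <ᵇ b) ∧ mixed b w) _ _ ⟩
  not (M <ᵇ b) ∧ mixed b w ∨ (any (f M) (subseqs 3 w) ∨ (any (f b) (subseqs 3 w) ∨ rest))
    ≡⟨ cong (not (M <ᵇ b) ∧ mixed b w ∨_) (∨-assoc (any (f M) (subseqs 3 w)) _ _) ⟨
  not (M <ᵇ b) ∧ mixed b w ∨ ((any (f M) (subseqs 3 w) ∨ any (f b) (subseqs 3 w)) ∨ rest)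
    ≡⟨ cong (λ u → not (M <ᵇ b) ∧ mixed b w ∨ (u ∨ rest))
         (trans (any-∨ (f M) (f b) (subseqs 3 w)) (any-cong f-⊔ (subseqs 3 w))) ⟩
  not (M <ᵇ b) ∧ mixed b w ∨ bad (M ⊔ b) w ∎
  where
  f : ℕ → List ℕ → Bool
  f a s = forbidden (a ∷ s)
  rest : Bool
  rest = any forbidden (subseqs 4 w)
  f-⊔ : ∀ s → f M s ∨ f b s ≡ f (M ⊔ b) s
  f-⊔ []                  = refl
  f-⊔ (_ ∷ [])            = refl
  f-⊔ (_ ∷ _ ∷ [])        = refl
  f-⊔ (_ ∷ _ ∷ _ ∷ _ ∷ _) = refl
  f-⊔ (c ∷ d ∷ e ∷ [])    rewrite ⊔-<ᵇ M b c with M <ᵇ c | b <ᵇ c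
  ... | true  | _     = refl
  ... | false | true  = ∨-identityʳ _
  ... | false | false = ∨-idem _

avoidsT₁-∷ : ∀ a w → avoidsT₁ (a ∷ w) ≡ not (bad a w)
avoidsT₁-∷ a w = trans (avoidsT₁≡ (a ∷ w)) (cong not (trans
  (any-++ forbidden (map (a ∷_) (subseqs 3 w)) _)
  (cong (_∨ _) (any-map forbidden (a ∷_) (subseqs 3 w)))))

-- Counting good permutations

count : (A → Bool) → List A → ℕ
count p xs = length (filterᵇ p xs)

count-∷ : ∀ (p : A → Bool) x xs → count p (x ∷ xs) ≡ (if p x then 1 else 0) + count p xs
count-∷ p x xs with p x
... | true  = refl
... | false = refl

count-congᴬ : ∀ {p q : A → Bool} {xs} → All (λ x → p x ≡ q x) xs → count p xs ≡ count q xs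
count-congᴬ []                                = refl
count-congᴬ {p = p} {q} {x ∷ xs} (px≡qx ∷ p≗q)
  rewrite count-∷ p x xs | count-∷ q x xs | px≡qx = cong (_ +_) (count-congᴬ p≗q)

count-cong : ∀ {p q : A → Bool} → (∀ x → p x ≡ q x) → ∀ xs → count p xs ≡ count q xs
count-cong p≗q xs = count-congᴬ (All.universal p≗q xs)

count-none : ∀ (xs : List A) → count (λ _ → false) xs ≡ 0
count-none []       = refl
count-none (x ∷ xs) = count-none xs

count-++ : ∀ (p : A → Bool) xs ys → count p (xs ++ ys) ≡ count p xs + count p ys
count-++ p []       ys = refl
count-++ p (x ∷ xs) ys with p x
... | true  = cong suc (count-++ p xs ys)
... | false = count-++ p xs ys

count-map : ∀ (p : A → Bool) (f : B → A) xs → count p (map f xs) ≡ count (p ∘ f) xs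
count-map p f []       = refl
count-map p f (x ∷ xs) with p (f x)
... | true  = cong suc (count-map p f xs)
... | false = count-map p f xs

count-filterᵇ : ∀ (p q : A → Bool) xs → count p (filterᵇ q xs) ≡ count (λ x → q x ∧ p x) xs
count-filterᵇ p q []       = refl
count-filterᵇ p q (x ∷ xs) with q x
... | false = count-filterᵇ p q xs
... | true with p x
...   | true  = cong suc (count-filterᵇ p q xs)
...   | false = count-filterᵇ p q xs

count-concatMap : ∀ (p : A → Bool) (f : B → List A) xs →
                  count p (concatMap f xs) ≡ sum (map (λ x → count p (f x)) xs)
count-concatMap p f []       = refl
count-concatMap p f (x ∷ xs) =
  trans (count-++ p (f x) (concatMap f xs)) (cong (count p (f x) +_) (count-concatMap p f xs))

sum-map-+ : ∀ (f g : A → ℕ) xs → sum (map (λ x → f x + g x) xs) ≡ sum (map f xs) + sum (map g xs)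
sum-map-+ f g []       = refl
sum-map-+ f g (x ∷ xs) = trans (cong (f x + g x +_) (sum-map-+ f g xs)) (interchange (f x) (g x) _ _)

sum-map-0 : ∀ (xs : List A) → sum (map (λ _ → 0) xs) ≡ 0
sum-map-0 []       = refl
sum-map-0 (x ∷ xs) = sum-map-0 xs

count-swap : ∀ (p : A → B → Bool) xs ys →
             sum (map (λ y → count (λ x → p x y) xs) ys) ≡ sum (map (λ x → count (p x) ys) xs)
count-swap p xs []       = sym (sum-map-0 xs)
count-swap p xs (y ∷ ys) = begin
  count (λ x → p x y) xs + sum (map (λ y → count (λ x → p x y) xs) ys)
    ≡⟨ cong₂ _+_ (count-sum xs) (count-swap p xs ys) ⟩
  sum (map (λ x → if p x y then 1 else 0) xs) + sum (map (λ x → count (p x) ys) xs)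
    ≡⟨ sum-map-+ _ _ xs ⟨
  sum (map (λ x → (if p x y then 1 else 0) + count (p x) ys) xs)
    ≡⟨ cong sum (map-cong (λ x → count-∷ (p x) y ys) xs) ⟨
  sum (map (λ x → count (p x) (y ∷ ys)) xs) ∎
  where
  count-sum : ∀ xs → count (λ x → p x y) xs ≡ sum (map (λ x → if p x y then 1 else 0) xs)
  count-sum []       = refl
  count-sum (x ∷ xs) = trans (count-∷ (λ x → p x y) x xs) (cong (_ +_) (count-sum xs))

-- Drawing letters without replacement

picks : List A → List (A × List A)
picks []       = []
picks (x ∷ xs) = (x , xs) ∷ map (map₂ (x ∷_)) (picks xs)

perms : ℕ → List A → List (List A)
perms zero    xs = [ [] ]
perms (suc m) xs = concatMap (uncurry λ x ys → map (x ∷_) (perms m ys)) (picks xs)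

sumPicks : (A → List A → ℕ) → List A → ℕ
sumPicks g xs = sum (map (uncurry g) (picks xs))

sumPicks-∷ : ∀ (g : A → List A → ℕ) x xs →
             sumPicks g (x ∷ xs) ≡ g x xs + sumPicks (λ y ys → g y (x ∷ ys)) xs
sumPicks-∷ g x xs = cong (λ l → g x xs + sum l) (sym (map-∘ (picks xs)))

sumPicks-++ : ∀ (g : A → List A → ℕ) xs ys → sumPicks g (xs ++ ys) ≡
              sumPicks (λ z zs → g z (zs ++ ys)) xs + sumPicks (λ z zs → g z (xs ++ zs)) ys
sumPicks-++ g []       ys = refl
sumPicks-++ g (x ∷ xs) ys = begin
  sumPicks g (x ∷ xs ++ ys)
    ≡⟨ sumPicks-∷ g x (xs ++ ys) ⟩
  g x (xs ++ ys) + sumPicks (λ z zs → g z (x ∷ zs)) (xs ++ ys)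
    ≡⟨ cong (g x (xs ++ ys) +_) (sumPicks-++ (λ z zs → g z (x ∷ zs)) xs ys) ⟩
  g x (xs ++ ys) + (sumPicks (λ z zs → g z (x ∷ zs ++ ys)) xs + sumPicks (λ z zs → g z (x ∷ xs ++ zs)) ys)
    ≡⟨ +-assoc (g x (xs ++ ys)) _ _ ⟨
  g x (xs ++ ys) + sumPicks (λ z zs → g z (x ∷ zs ++ ys)) xs + sumPicks (λ z zs → g z (x ∷ xs ++ zs)) ys
    ≡⟨ cong (_+ sumPicks (λ z zs → g z (x ∷ xs ++ zs)) ys) (sumPicks-∷ (λ z zs → g z (zs ++ ys)) x xs) ⟨
  sumPicks (λ z zs → g z (zs ++ ys)) (x ∷ xs) + sumPicks (λ z zs → g z (x ∷ xs ++ zs)) ys ∎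

count-perms : ∀ (p : List A → Bool) m xs →
              count p (perms (suc m) xs) ≡ sumPicks (λ x ys → count (p ∘ (x ∷_)) (perms m ys)) xs
count-perms p m xs = trans (count-concatMap p _ (picks xs))
  (cong sum (map-cong (λ (x , ys) → count-map p (x ∷_) (perms m ys)) (picks xs)))

picks-↭ : ∀ (xs : List A) → All (uncurry λ y ys → xs ↭ y ∷ ys) (picks xs)
picks-↭ []       = []
picks-↭ (x ∷ xs) = ↭-refl ∷ All.map⁺ (All.map (λ {(y , ys)} r → ↭-trans (prep x r) (swap x y ↭-refl)) (picks-↭ xs))

perms-↭ : ∀ m (xs : List A) → length xs ≡ m → All (_↭ xs) (perms m xs)
perms-↭ zero    []       _ = ↭-refl ∷ []
perms-↭ (suc m) xs       e = All.concat⁺ (All.map⁺ (All.map step (picks-↭ xs)))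
  where
  step : ∀ {y} → xs ↭ proj₁ y ∷ proj₂ y → All (_↭ xs) (map (proj₁ y ∷_) (perms m (proj₂ y)))
  step {y , ys} r = All.map⁺ (All.map (λ s → ↭-trans (prep y s) (↭-sym r))
    (perms-↭ m ys (suc-injective (trans (sym (↭-length r)) e))))

-- Removing a letter from filterᵇ u X by shrinking u keeps X, hence the word length bound, fixed.
_∖_ : (ℕ → Bool) → ℕ → ℕ → Bool
(u ∖ a) b = u b ∧ not (a ≡ᵇ b)

Distinct : List ℕ → Set
Distinct = AllPairs (λ x y → (x ≡ᵇ y) ≡ false)

≡ᵇ-sym : ∀ m n → (m ≡ᵇ n) ≡ (n ≡ᵇ m)
≡ᵇ-sym zero    zero    = refl
≡ᵇ-sym zero    (suc n) = refl
≡ᵇ-sym (suc m) zero    = refl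
≡ᵇ-sym (suc m) (suc n) = ≡ᵇ-sym m n

≡ᵇ-refl : ∀ n → (n ≡ᵇ n) ≡ true
≡ᵇ-refl zero    = refl
≡ᵇ-refl (suc n) = ≡ᵇ-refl n

filterᵇ-∖ : ∀ u a xs → All (λ x → (a ≡ᵇ x) ≡ false) xs → filterᵇ (u ∖ a) xs ≡ filterᵇ u xs
filterᵇ-∖ u a []       []       = refl
filterᵇ-∖ u a (x ∷ xs) (p ∷ ps) rewrite p | ∧-identityʳ (u x) | filterᵇ-∖ u a xs ps = refl

sumPicks-filterᵇ : ∀ (g : ℕ → List ℕ → ℕ) u xs → Distinct xs → sumPicks g (filterᵇ u xs) ≡
                   sum (map (λ a → if u a then g a (filterᵇ (u ∖ a) xs) else 0) xs)
sumPicks-filterᵇ g u []       _        = refl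
sumPicks-filterᵇ g u (x ∷ xs) (d ∷ ds)
  rewrite ≡ᵇ-refl x | ∧-zeroʳ (u x) | filterᵇ-∖ u x xs d with u x
... | true  = trans (sumPicks-∷ g x (filterᵇ u xs)) (cong (g x (filterᵇ u xs) +_)
  (trans (sumPicks-filterᵇ (λ y ys → g y (x ∷ ys)) u xs ds) (cong sum (map-cong-local (All.map keep d)))))
  where
  keep : ∀ {a} → (x ≡ᵇ a) ≡ false →
         (if u a then g a (x ∷ filterᵇ (u ∖ a) xs) else 0) ≡
         (if u a then g a (if not (a ≡ᵇ x) then x ∷ filterᵇ (u ∖ a) xs else filterᵇ (u ∖ a) xs) else 0)
  keep {a} e rewrite ≡ᵇ-sym a x | e = refl
... | false = sumPicks-filterᵇ g u xs ds

-- A word without repetitions is a sequence of draws from a shrinking set of letters. The predicate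
-- `u` of letters still available and the property `p` of the rest of the word vary, so that the
-- induction on `m` passes to the tail.
words-perms : ∀ n p u m → Distinct (applyUpTo suc n) →
  count (λ w → (all u w ∧ distinct w) ∧ p w) (words n m) ≡ count p (perms m (filterᵇ u (applyUpTo suc n)))
words-perms n p u zero    d = refl
words-perms n p u (suc m) d = begin
  count q (concatMap (λ w → map (_∷ w) X) (words n m))
    ≡⟨ count-concatMap q (λ w → map (_∷ w) X) (words n m) ⟩
  sum (map (λ w → count q (map (_∷ w) X)) (words n m))
    ≡⟨ cong sum (map-cong (λ w → count-map q (_∷ w) X) (words n m)) ⟩
  sum (map (λ w → count (λ a → q (a ∷ w)) X) (words n m))
    -- `words` runs over tails in its outer loop; exchanging the sums puts the first letter outside,
    -- as in `perms`.
    ≡⟨ count-swap (λ a w → q (a ∷ w)) X (words n m) ⟩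
  sum (map (λ a → count (λ w → q (a ∷ w)) (words n m)) X)
    ≡⟨ cong sum (map-cong first X) ⟩
  sum (map (λ a → if u a then count (p ∘ (a ∷_)) (perms m (filterᵇ (u ∖ a) X)) else 0) X)
    ≡⟨ sumPicks-filterᵇ (λ a ys → count (p ∘ (a ∷_)) (perms m ys)) u X d ⟨
  sumPicks (λ a ys → count (p ∘ (a ∷_)) (perms m ys)) (filterᵇ u X)
    ≡⟨ count-perms p m (filterᵇ u X) ⟨
  count p (perms (suc m) (filterᵇ u X)) ∎
  where
  X : List ℕ
  X = applyUpTo suc n
  q : List ℕ → Bool
  q w = (all u w ∧ distinct w) ∧ p w
  all-∖ : ∀ a w → all u w ∧ not (any (a ≡ᵇ_) w) ≡ all (u ∖ a) w
  all-∖ a []      = refl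
  all-∖ a (b ∷ w) rewrite sym (all-∖ a w) with u b | a ≡ᵇ b
  ... | false | _     = refl
  ... | true  | true  = ∧-zeroʳ _
  ... | true  | false = refl
  first : ∀ a → count (λ w → q (a ∷ w)) (words n m) ≡
                (if u a then count (p ∘ (a ∷_)) (perms m (filterᵇ (u ∖ a) X)) else 0)
  first a with u a
  ... | false = count-none (words n m)
  ... | true  = trans
    (count-cong (λ w → cong (_∧ p (a ∷ w)) (trans (sym (∧-assoc (all u w) _ _)) (cong (_∧ distinct w) (all-∖ a w)))) (words n m))
    (words-perms n (p ∘ (a ∷_)) (u ∖ a) m d)

-- completions l r counts the ways to continue a good prefix when l of the unused values lie
-- below its maximum and r above it.
completions : ℕ → ℕ → ℕ
completions l       (suc zero)    = 2 ^ l
completions zero    zero          = 1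
completions (suc l) zero          = 2 ^ l
completions zero    (suc (suc r)) = completions 1 (suc r)
completions (suc l) (suc (suc r)) = completions l (suc (suc r)) + completions (2 + l) (suc r)

-- An antidiagonal sum of `n` terms: the arguments of `v` add up to i + n - 1 in each.
splitSum : (ℕ → ℕ → ℕ) → ℕ → ℕ → ℕ
splitSum v i zero    = 0
splitSum v i (suc n) = v i n + splitSum v (suc i) n

splitSum-+ : ∀ v l i n → splitSum (λ i j → v (l + i) j) i n ≡ splitSum v (l + i) n
splitSum-+ v l i zero    = refl
splitSum-+ v l i (suc n) = cong (v (l + i) n +_)
  (trans (splitSum-+ v l (suc i) n) (cong (λ k → splitSum v k n) (+-suc l i)))

-- Here letters give way to numbers: for a sorted `S`, `length P` and `length U` count the values
-- below and above the chosen one.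
sumPicks-splitSum : ∀ (g : A → List A → ℕ) v S →
  (∀ P a U → P ++ a ∷ U ≡ S → g a (P ++ U) ≡ v (length P) (length U)) →
  sumPicks g S ≡ splitSum v 0 (length S)
sumPicks-splitSum {A} g v S hyp = go [] S refl
  where
  go : ∀ P U → P ++ U ≡ S → sumPicks (λ a V → g a (P ++ V)) U ≡ splitSum v (length P) (length U)
  go P []      _ = refl
  go P (a ∷ U) e = begin
    sumPicks (λ b V → g b (P ++ V)) (a ∷ U)
      ≡⟨ sumPicks-∷ (λ b V → g b (P ++ V)) a U ⟩
    g a (P ++ U) + sumPicks (λ b V → g b (P ++ a ∷ V)) U
      ≡⟨ cong₂ _+_ (hyp P a U e) (cong sum (map-cong (λ (b , V) → cong (g b) (sym (∷ʳ-++ P a V))) (picks U))) ⟩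
    v (length P) (length U) + sumPicks (λ b V → g b ((P ∷ʳ a) ++ V)) U
      ≡⟨ cong (v (length P) (length U) +_) (go (P ∷ʳ a) U (trans (∷ʳ-++ P a U) e)) ⟩
    v (length P) (length U) + splitSum v (length (P ∷ʳ a)) (length U)
      ≡⟨ cong (λ k → v (length P) (length U) + splitSum v k (length U)) (trans (length-++ P) (+-comm (length P) 1)) ⟩
    v (length P) (length U) + splitSum v (suc (length P)) (length U) ∎

-- A letter below the current maximum is admissible only if it is the least or the greatest unused
-- value; i and j count the unused values below the maximum that are smaller and larger than it, and
-- r the unused values above the maximum.
lowValue : ℕ → ℕ → ℕ → ℕ → ℕ
lowValue F r       zero    j       = F
lowValue F zero    (suc i) zero    = F
lowValue F zero    (suc i) (suc j) = 0
lowValue F (suc r) (suc i) j       = 0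

splitSum-lowValue : ∀ F r i n → splitSum (lowValue F (suc r)) (suc i) n ≡ 0
splitSum-lowValue F r i zero    = refl
splitSum-lowValue F r i (suc n) = splitSum-lowValue F r (suc i) n

splitSum-lowValue₀ : ∀ F i n → splitSum (lowValue F 0) (suc i) (suc n) ≡ F
splitSum-lowValue₀ F i zero    = +-identityʳ F
splitSum-lowValue₀ F i (suc n) = splitSum-lowValue₀ F (suc i) n

-- Telescoping: after its first term the sum for `(suc l, 2 + r)` is the one for `(2 + l, suc r)`,
-- so by induction the whole sum is `completions (2 + l) (suc r)`. This is why three terms suffice
-- in the definition.
completions-rec⁺ : ∀ l r → completions (suc l) (suc r) ≡ completions l (suc r) + splitSum completions (suc l) (suc r)
completions-rec⁺ l zero    = refl
completions-rec⁺ l (suc r) = cong (completions l (2 + r) +_) (completions-rec⁺ (suc l) r)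

-- The count by the next letter, low letters in the first sum and new maxima in the second. The
-- hypothesis excludes `(0, 0)`, where both sums are empty but the empty continuation counts once.
completions-rec : ∀ m l r → l + r ≡ suc m →
  splitSum (lowValue (completions (pred l) r) r) 0 l + splitSum completions l r ≡ completions l r
completions-rec m zero          (suc zero)    _ = refl
completions-rec m zero          (suc (suc r)) _ = sym (completions-rec⁺ 0 r)
completions-rec m (suc zero)    zero          _ = refl
completions-rec m (suc (suc l)) zero          _ =
  trans (+-identityʳ _) (cong (2 ^ l +_) (trans (splitSum-lowValue₀ (2 ^ l) 0 l) (sym (+-identityʳ (2 ^ l)))))
completions-rec m (suc l)       (suc r)       _ = begin
  completions l (suc r) + splitSum (lowValue (completions l (suc r)) (suc r)) 1 l + splitSum completions (suc l) (suc r)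
    ≡⟨ cong (λ z → completions l (suc r) + z + splitSum completions (suc l) (suc r))
            (splitSum-lowValue (completions l (suc r)) r 0 l) ⟩
  completions l (suc r) + 0 + splitSum completions (suc l) (suc r)
    ≡⟨ cong (_+ splitSum completions (suc l) (suc r)) (+-identityʳ (completions l (suc r))) ⟩
  completions l (suc r) + splitSum completions (suc l) (suc r)
    ≡⟨ completions-rec⁺ l r ⟨
  completions (suc l) (suc r) ∎

Sorted : List ℕ → Set
Sorted = AllPairs _<_

Sorted-++⁻ : ∀ P {a U} → Sorted (P ++ a ∷ U) → All (_< a) P × All (a <_) U × Sorted (P ++ U)
Sorted-++⁻ []      (a<U ∷ s) = [] , a<U , s
Sorted-++⁻ (p ∷ P) (p< ∷ s) with Sorted-++⁻ P s | All.++⁻ P p<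
... | P<a , a<U , s′ | p<P , p<a ∷ p<U = p<a ∷ P<a , a<U , All.++⁺ p<P p<U ∷ s′

any-<-true : ∀ a P c U → a < c → any (a <ᵇ_) (P ++ c ∷ U) ≡ true
any-<-true a []      c U a<c rewrite <ᵇ-true a c a<c = refl
any-<-true a (p ∷ P) c U a<c rewrite any-<-true a P c U a<c = ∨-zeroʳ _

any-<-false : ∀ {a P} → All (_< a) P → any (a <ᵇ_) P ≡ false
any-<-false []                          = refl
any-<-false {a} {p ∷ P} (p<a ∷ P<a) rewrite <ᵇ-false a p (<⇒≤ p<a) = any-<-false P<a

any-≮-false : ∀ {a U} → All (a <_) U → any (λ c → not (a <ᵇ c)) U ≡ false
any-≮-false []                          = refl
any-≮-false {a} {c ∷ U} (a<c ∷ a<U) rewrite <ᵇ-true a c a<c = any-≮-false a<U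

good : ℕ → List ℕ → Bool
good M w = not (bad M w)

good-high : ∀ {M a} → M < a → ∀ w → good M (a ∷ w) ≡ good a w
good-high {M} {a} M<a w rewrite bad-∷ M a w | <ᵇ-true M a M<a | m≤n⇒m⊔n≡n (<⇒≤ M<a) = refl

good-low : ∀ {M a} → a < M → ∀ w → good M (a ∷ w) ≡ not (mixed a w ∨ bad M w)
good-low {M} {a} a<M w rewrite bad-∷ M a w | <ᵇ-false M a (<⇒≤ a<M) | m≥n⇒m⊔n≡m (<⇒≤ a<M) = refl

-- Whether `a` is `mixed` does not depend on the order of the later letters, so one test on `V`
-- serves all its arrangements.
count-good-low : ∀ {M a} m V → a < M → length V ≡ m →
  count (λ w → good M (a ∷ w)) (perms m V) ≡ (if mixed a V then 0 else count (good M) (perms m V))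
count-good-low {M} {a} m V a<M e = trans (count-congᴬ (All.map step (perms-↭ m V e))) split
  where
  step : ∀ {w} → w ↭ V → good M (a ∷ w) ≡ not (mixed a V ∨ bad M w)
  step {w} w↭V = trans (good-low a<M w)
    (cong (λ b → not (b ∨ bad M w)) (cong₂ _∧_ (any-↭ _ w↭V) (any-↭ _ w↭V)))
  split : count (λ w → not (mixed a V ∨ bad M w)) (perms m V) ≡ (if mixed a V then 0 else count (good M) (perms m V))
  split with mixed a V
  ... | true  = count-none (perms m V)
  ... | false = refl

-- Induction over the next letter `a`. Above `M` it becomes the maximum, and the part `P` of `R`
-- below it joins `L`. Below `M` it leaves the maximum unchanged, so every admissible choice
-- contributes the same number `F`.
count-good : ∀ m M L R → Sorted (L ++ R) → All (_< M) L → All (M <_) R → length L + length R ≡ m →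
             count (good M) (perms m (L ++ R)) ≡ completions (length L) (length R)
count-good zero    M []      []      _ _ _ _ = refl
count-good (suc m) M L R s L<M M<R e = begin
  count (good M) (perms (suc m) (L ++ R))
    ≡⟨ count-perms (good M) m (L ++ R) ⟩
  sumPicks g (L ++ R)
    ≡⟨ sumPicks-++ g L R ⟩
  sumPicks (λ a V → g a (V ++ R)) L + sumPicks (λ a V → g a (L ++ V)) R
    ≡⟨ cong₂ _+_ (sumPicks-splitSum _ (lowValue F (length R)) L low)
                 (sumPicks-splitSum _ (λ i j → completions (length L + i) j) R high) ⟩
  splitSum (lowValue F (length R)) 0 (length L) + splitSum (λ i j → completions (length L + i) j) 0 (length R)
    ≡⟨ cong (splitSum (lowValue F (length R)) 0 (length L) +_) (trans (splitSum-+ completions (length L) 0 (length R))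
                          (cong (λ l → splitSum completions l (length R)) (+-identityʳ (length L)))) ⟩
  splitSum (lowValue F (length R)) 0 (length L) + splitSum completions (length L) (length R)
    ≡⟨ completions-rec m (length L) (length R) e ⟩
  completions (length L) (length R) ∎
  where
  g : ℕ → List ℕ → ℕ
  g a V = count (λ w → good M (a ∷ w)) (perms m V)
  F : ℕ
  F = completions (pred (length L)) (length R)
  high : ∀ P a U → P ++ a ∷ U ≡ R → g a (L ++ (P ++ U)) ≡ completions (length L + length P) (length U)
  high P a U refl with Sorted-++⁻ (L ++ P) (subst Sorted (sym (++-assoc L P (a ∷ U))) s) | All.++⁻ʳ P M<R
  ... | LP<a , a<U , s′ | M<a ∷ _ = begin
    g a (L ++ (P ++ U))
      ≡⟨ count-cong (good-high M<a) (perms m (L ++ (P ++ U))) ⟩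
    count (good a) (perms m (L ++ (P ++ U)))
      ≡⟨ cong (λ V → count (good a) (perms m V)) (++-assoc L P U) ⟨
    count (good a) (perms m ((L ++ P) ++ U))
      ≡⟨ count-good m a (L ++ P) U s′ LP<a a<U (suc-injective (trans lengths e)) ⟩
    completions (length (L ++ P)) (length U)
      ≡⟨ cong (λ l → completions l (length U)) (length-++ L) ⟩
    completions (length L + length P) (length U) ∎
    where
    lengths : suc (length (L ++ P) + length U) ≡ length L + length (P ++ a ∷ U)
    lengths rewrite length-++ L {P} | length-++ P {a ∷ U} | +-suc (length P) (length U)
                  | +-suc (length L) (length P + length U) = cong suc (+-assoc (length L) _ _)
  low : ∀ P a U → P ++ a ∷ U ≡ L → g a ((P ++ U) ++ R) ≡ lowValue F (length R) (length P) (length U)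
  low P a U refl with Sorted-++⁻ P (subst Sorted (++-assoc P (a ∷ U) R) s) | All.++⁻ P L<M
  ... | P<a , a<UR , s′ | P<M , a<M ∷ U<M =
    trans (count-good-low m ((P ++ U) ++ R) a<M (trans (length-++ (P ++ U)) size)) (byCase P U R refl refl refl)
    where
    lengths : length (P ++ a ∷ U) ≡ suc (length (P ++ U))
    lengths rewrite length-++ P {a ∷ U} | length-++ P {U} = +-suc (length P) (length U)
    size : length (P ++ U) + length R ≡ m
    size = suc-injective (trans (cong (_+ length R) (sym lengths)) e)
    rest : count (good M) (perms m ((P ++ U) ++ R)) ≡ F
    rest = trans (count-good m M (P ++ U) R (subst Sorted (sym (++-assoc P U R)) s′) (All.++⁺ P<M U<M) M<R size)
                 (cong (λ l → completions (pred l) (length R)) (sym lengths))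
    Value : ℕ
    Value = if mixed a ((P ++ U) ++ R) then 0 else count (good M) (perms m ((P ++ U) ++ R))
    unmixed : mixed a ((P ++ U) ++ R) ≡ false → Value ≡ F
    unmixed e rewrite e = rest
    mixed-vanishes : mixed a ((P ++ U) ++ R) ≡ true → Value ≡ 0
    mixed-vanishes e rewrite e = refl
    mixed-true : ∀ p P c T → p < a → a < c → mixed a (p ∷ P ++ c ∷ T) ≡ true
    mixed-true p P c T p<a a<c
      rewrite any-<-true a (p ∷ P) c T a<c | <ᵇ-false a p (<⇒≤ p<a) = refl
    byCase : ∀ P′ U′ R′ → P′ ≡ P → U′ ≡ U → R′ ≡ R → Value ≡ lowValue F (length R′) (length P′) (length U′)
    byCase []      U′ R′ refl refl refl =
      unmixed (trans (cong (any (a <ᵇ_) (U′ ++ R′) ∧_) (any-≮-false a<UR)) (∧-zeroʳ _))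
    byCase (p ∷ P′) [] [] refl refl refl =
      unmixed (cong (_∧ any (λ c → not (a <ᵇ c)) ((P ++ []) ++ []))
        (trans (cong (any (a <ᵇ_)) (trans (++-identityʳ (P ++ [])) (++-identityʳ P))) (any-<-false P<a)))
    byCase (p ∷ P′) [] (c ∷ R′) refl refl refl =
      mixed-vanishes (trans (cong (mixed a) (++-assoc P [] R))
        (mixed-true p P′ c R′ (All.head P<a) (All.head a<UR)))
    byCase (p ∷ P′) (c ∷ U′) R′ refl refl refl =
      trans (mixed-vanishes (trans (cong (mixed a) (++-assoc P (c ∷ U′) R′))
        (mixed-true p P′ c (U′ ++ R′) (All.head P<a) (All.head a<UR)))) (zero-value R′)
      where
      zero-value : ∀ R′ → 0 ≡ lowValue F (length R′) (suc (length P′)) (suc (length U′))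
      zero-value []       = refl
      zero-value (_ ∷ _)  = refl

-- Counting by the first entry

≡ᵇ-false : ∀ {m n} → m < n → (m ≡ᵇ n) ≡ false
≡ᵇ-false {zero}  {suc n} _         = refl
≡ᵇ-false {suc m} {suc n} (s≤s m<n) = ≡ᵇ-false m<n

-- Values start at 1, so the first entry with `i` values below it is `suc i`; it is its own prefix
-- maximum.
startingWith : ℕ → ℕ → ℕ → ℕ
startingWith k i j = if suc i ≡ᵇ k then completions i j else 0

splitSum-startingWith-none : ∀ k i n → (∀ j → i ≤ j → j < i + n → (suc j ≡ᵇ k) ≡ false) →
                             splitSum (startingWith k) i n ≡ 0
splitSum-startingWith-none k i zero    ≢k = refl
splitSum-startingWith-none k i (suc n) ≢k
  rewrite ≢k i ≤-refl (m<m+n i z<s) =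
  splitSum-startingWith-none k (suc i) n λ j i<j j<i+n → ≢k j (<⇒≤ i<j) (<-≤-trans j<i+n (≤-reflexive (sym (+-suc i n))))

-- Induction on `d`, the number of vanishing terms before the only one that survives.
splitSum-startingWith : ∀ i d r → splitSum (startingWith (suc (d + i))) i (suc (d + r)) ≡ completions (d + i) r
splitSum-startingWith i zero    r rewrite ≡ᵇ-refl i = trans (cong (completions i r +_) (
  splitSum-startingWith-none (suc i) (suc i) r λ j i<j _ → trans (≡ᵇ-sym j i) (≡ᵇ-false i<j))) (+-identityʳ _)
splitSum-startingWith i (suc d) r = trans
  (cong (λ b → (if b then completions i (suc d + r) else 0) +
                splitSum (startingWith (2 + (d + i))) (suc i) (suc (d + r)))
        (≡ᵇ-false (s≤s (m≤n+m i d))))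
  (subst (λ k → splitSum (startingWith (suc k)) (suc i) (suc (d + r)) ≡ completions k r) (+-suc d i)
         (splitSum-startingWith (suc i) d r))

applyUpTo-split : ∀ (f : ℕ → A) n P a U → P ++ a ∷ U ≡ applyUpTo f n → a ≡ f (length P)
applyUpTo-split f (suc n) []      a U refl = refl
applyUpTo-split f (suc n) (p ∷ P) a U e    = applyUpTo-split (f ∘ suc) n P a U (∷-injectiveʳ e)

h-splitSum : ∀ n k → h (suc n) k ≡ splitSum (startingWith k) 0 (suc n)
h-splitSum n k = begin
  count q (filterᵇ distinct (words N N))
    ≡⟨ count-filterᵇ q distinct (words N N) ⟩
  count (λ w → distinct w ∧ q w) (words N N)
    ≡⟨ count-cong (λ w → cong (λ b → (b ∧ distinct w) ∧ q w) (all-true w)) (words N N) ⟨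
  count (λ w → (all (λ _ → true) w ∧ distinct w) ∧ q w) (words N N)
    ≡⟨ words-perms N q (λ _ → true) N (AllPairs.map (λ {x} {y} → ≡ᵇ-false {x} {y}) sorted) ⟩
  count q (perms N (filterᵇ (λ _ → true) X))
    ≡⟨ cong (λ V → count q (perms N V)) (filterᵇ-true X) ⟩
  count q (perms N X)
    ≡⟨ count-perms q n X ⟩
  sumPicks (λ a V → count (λ w → q (a ∷ w)) (perms n V)) X
    ≡⟨ sumPicks-splitSum _ (startingWith k) X value ⟩
  splitSum (startingWith k) 0 (length X)
    ≡⟨ cong (splitSum (startingWith k) 0) (length-applyUpTo suc N) ⟩
  splitSum (startingWith k) 0 N ∎
  where
  N : ℕ
  N = suc n
  X : List ℕ
  X = applyUpTo suc N
  q : List ℕ → Bool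
  q σ = avoidsT₁ σ ∧ firstIs k σ
  sorted : Sorted X
  sorted = AllPairs.applyUpTo⁺₁ suc N λ i<j _ → s≤s i<j
  all-true : ∀ (w : List ℕ) → all (λ _ → true) w ≡ true
  all-true []      = refl
  all-true (_ ∷ w) = all-true w
  filterᵇ-true : ∀ (w : List ℕ) → filterᵇ (λ _ → true) w ≡ w
  filterᵇ-true []      = refl
  filterᵇ-true (a ∷ w) = cong (a ∷_) (filterᵇ-true w)
  value : ∀ P a U → P ++ a ∷ U ≡ X →
          count (λ w → q (a ∷ w)) (perms n (P ++ U)) ≡ startingWith k (length P) (length U)
  value P a U e with applyUpTo-split suc N P a U e | Sorted-++⁻ P (subst Sorted (sym e) sorted)
  ... | refl | P<a , a<U , s = trans (count-cong (λ w → cong (_∧ (a ≡ᵇ k)) (avoidsT₁-∷ a w)) (perms n (P ++ U))) byCase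
    where
    size : length P + length U ≡ n
    size = suc-injective (trans (sym (+-suc (length P) (length U)))
      (trans (sym (length-++ P)) (trans (cong length e) (length-applyUpTo suc N))))
    byCase : count (λ w → good a w ∧ (a ≡ᵇ k)) (perms n (P ++ U)) ≡ startingWith k (length P) (length U)
    byCase with suc (length P) ≡ᵇ k
    ... | false = trans (count-cong (λ w → ∧-zeroʳ (good a w)) (perms n (P ++ U))) (count-none (perms n (P ++ U)))
    ... | true  = trans (count-cong (λ w → ∧-identityʳ (good a w)) (perms n (P ++ U)))
                        (count-good n a P U s P<a a<U size)

h-inside : ∀ k r → h (suc (k + r)) (suc k) ≡ completions k r
h-inside k r = trans (h-splitSum (k + r) (suc k))
  (subst (λ d → splitSum (startingWith (suc d)) 0 (suc (k + r)) ≡ completions d r) (+-identityʳ k)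
         (splitSum-startingWith 0 k r))

h-above : ∀ n k → n < k → h n k ≡ 0
h-above zero    k _   = refl
h-above (suc n) k n<k = trans (h-splitSum n k)
  (splitSum-startingWith-none k 0 (suc n) λ j _ j<n → ≡ᵇ-false (≤-<-trans j<n n<k))

h-zero : ∀ n → h n 0 ≡ 0
h-zero zero    = refl
h-zero (suc n) = trans (h-splitSum n 0) (splitSum-startingWith-none 0 0 (suc n) λ _ _ _ → refl)

-- Central binomial coefficients

nC0≡1 : ∀ n → n C 0 ≡ 1
nC0≡1 n = trans (nCk≡nC[n∸k] {0} {n} z≤n) (nCn≡1 n)

-- A window of `k` consecutive entries in row `n` of Pascal's triangle. The windows that matter,
-- columns r to r + l of row 2r + l, are symmetric about the middle: the whole row for r = 0, the
-- central entry for l = 0.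
binomialSum : ℕ → ℕ → ℕ → ℕ
binomialSum n a zero    = 0
binomialSum n a (suc k) = n C a + binomialSum n (suc a) k

binomialSum-pascal : ∀ n a k → binomialSum (suc n) (suc a) k ≡ binomialSum n a k + binomialSum n (suc a) k
binomialSum-pascal n a zero    = refl
binomialSum-pascal n a (suc k) = begin
  suc n C suc a + binomialSum (suc n) (2 + a) k
    ≡⟨ cong₂ _+_ (sym (nCk+nC[k+1]≡[n+1]C[k+1] n a)) (binomialSum-pascal n (suc a) k) ⟩
  (n C a + n C suc a) + (binomialSum n (suc a) k + binomialSum n (2 + a) k)
    ≡⟨ interchange (n C a) (n C suc a) _ _ ⟩
  binomialSum n a (suc k) + binomialSum n (suc a) (suc k) ∎

binomialSum-last : ∀ n a k → binomialSum n a (suc k) ≡ binomialSum n a k + n C (a + k)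
binomialSum-last n a zero    rewrite +-identityʳ a = +-identityʳ (n C a)
binomialSum-last n a (suc k) rewrite +-suc a k =
  trans (cong ((n C a) +_) (binomialSum-last n (suc a) k)) (sym (+-assoc (n C a) _ _))

binomialSum-row : ∀ n → binomialSum n 0 (suc n) ≡ 2 ^ n
binomialSum-row zero    = refl
binomialSum-row (suc n) = begin
  suc n C 0 + binomialSum (suc n) 1 (suc n)
    ≡⟨ cong₂ _+_ (trans (nC0≡1 (suc n)) (sym (nC0≡1 n))) (binomialSum-pascal n 0 (suc n)) ⟩
  n C 0 + (binomialSum n 0 (suc n) + binomialSum n 1 (suc n))
    ≡⟨ cong (λ z → n C 0 + (binomialSum n 0 (suc n) + z))
         (trans (binomialSum-last n 1 n) (trans (cong (binomialSum n 1 n +_) (k>n⇒nCk≡0 (n<1+n n))) (+-identityʳ _))) ⟩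
  n C 0 + (binomialSum n 0 (suc n) + binomialSum n 1 n)
    ≡⟨ x∙yz≈y∙xz (n C 0) (binomialSum n 0 (suc n)) _ ⟩
  binomialSum n 0 (suc n) + binomialSum n 0 (suc n)
    ≡⟨ cong₂ _+_ (binomialSum-row n) (trans (binomialSum-row n) (sym (+-identityʳ (2 ^ n)))) ⟩
  2 ^ suc n ∎

-- Pascal's rule turns the two summands of completions (suc l) (2 + r) into one sum of binomials.
completions-binomial : ∀ l r → completions l (suc r) ≡ binomialSum (r + r + l) r (suc l)
completions-binomial l       zero    = sym (binomialSum-row l)
completions-binomial zero    (suc r) = begin
  completions 1 (suc r)
    ≡⟨ completions-binomial 1 r ⟩
  binomialSum (r + r + 1) r 2
    ≡⟨ cong (λ n → binomialSum n r 2) (+-comm (r + r) 1) ⟩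
  suc (r + r) C r + (suc (r + r) C suc r + 0)
    ≡⟨ +-assoc (suc (r + r) C r) _ 0 ⟨
  suc (r + r) C r + suc (r + r) C suc r + 0
    ≡⟨ cong (_+ 0) (nCk+nC[k+1]≡[n+1]C[k+1] (suc (r + r)) r) ⟩
  (2 + (r + r)) C suc r + 0
    ≡⟨ cong (λ n → n C suc r + 0) (trans (+-identityʳ (suc r + suc r)) (cong suc (+-suc r r))) ⟨
  binomialSum (suc r + suc r + 0) (suc r) 1 ∎
completions-binomial (suc l) (suc r) = begin
  completions l (2 + r) + completions (2 + l) (suc r)
    ≡⟨ cong₂ _+_ (completions-binomial l (suc r)) (completions-binomial (2 + l) r) ⟩
  binomialSum (suc r + suc r + l) (suc r) (suc l) + binomialSum (r + r + (2 + l)) r (3 + l)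
    ≡⟨ cong₂ (λ m n → binomialSum m (suc r) (suc l) + binomialSum n r (3 + l))
         (cong suc (cong (_+ l) (+-suc r r))) (trans (+-suc (r + r) (suc l)) (cong suc (+-suc (r + r) l))) ⟩
  binomialSum n (suc r) (suc l) + binomialSum n r (3 + l)
    ≡⟨ cong (binomialSum n (suc r) (suc l) +_) (binomialSum-last n r (2 + l)) ⟩
  binomialSum n (suc r) (suc l) + (binomialSum n r (2 + l) + n C (r + (2 + l)))
    ≡⟨ x∙yz≈y∙xz (binomialSum n (suc r) (suc l)) (binomialSum n r (2 + l)) _ ⟩
  binomialSum n r (2 + l) + (binomialSum n (suc r) (suc l) + n C (r + (2 + l)))
    ≡⟨ cong (λ z → binomialSum n r (2 + l) + (binomialSum n (suc r) (suc l) + n C z)) (+-suc r (suc l)) ⟩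
  binomialSum n r (2 + l) + (binomialSum n (suc r) (suc l) + n C (suc r + suc l))
    ≡⟨ cong (binomialSum n r (2 + l) +_) (binomialSum-last n (suc r) (suc l)) ⟨
  binomialSum n r (2 + l) + binomialSum n (suc r) (2 + l)
    ≡⟨ binomialSum-pascal n r (2 + l) ⟨
  binomialSum (suc n) (suc r) (2 + l)
    ≡⟨ cong (λ m → binomialSum m (suc r) (2 + l))
         (trans (cong (λ m → suc (m + suc l)) (+-suc r r)) (cong (2 +_) (+-suc (r + r) l))) ⟨
  binomialSum (suc r + suc r + suc l) (suc r) (2 + l) ∎
  where
  n : ℕ
  n = 2 + (r + r + l)

centralBinomial : ℕ → ℕ
centralBinomial n = (n + n) C n

completions-zero : ∀ r → completions 0 (suc r) ≡ centralBinomial r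
completions-zero r = begin
  completions 0 (suc r)       ≡⟨ completions-binomial 0 r ⟩
  (r + r + 0) C r + 0         ≡⟨ +-identityʳ _ ⟩
  (r + r + 0) C r             ≡⟨ cong (_C r) (+-identityʳ (r + r)) ⟩
  centralBinomial r           ∎

C-absorption : ∀ n k → suc k * (suc n C suc k) ≡ suc n * (n C k)
C-absorption n       zero    = trans (*-identityˡ (suc n C 1)) (trans (nC1≡n (suc n))
  (sym (trans (cong (suc n *_) (nC0≡1 n)) (*-identityʳ (suc n)))))
C-absorption zero    (suc k) rewrite k>n⇒nCk≡0 {1} {2 + k} (s≤s z<s) = trans (*-zeroʳ k) (sym (cong (_+ 0) (k>n⇒nCk≡0 {0} {suc k} z<s)))
C-absorption (suc n) (suc k) = begin
  (2 + k) * ((2 + n) C (2 + k))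
    ≡⟨ cong ((2 + k) *_) (nCk+nC[k+1]≡[n+1]C[k+1] (suc n) (suc k)) ⟨
  (2 + k) * (suc n C suc k + suc n C (2 + k))
    ≡⟨ *-distribˡ-+ (2 + k) (suc n C suc k) _ ⟩
  (suc n C suc k + suc k * (suc n C suc k)) + (2 + k) * (suc n C (2 + k))
    ≡⟨ cong₂ (λ u v → suc n C suc k + u + v) (C-absorption n k) (C-absorption n (suc k)) ⟩
  (suc n C suc k + suc n * (n C k)) + suc n * (n C suc k)
    ≡⟨ trans (+-assoc (suc n C suc k) _ _) (cong ((suc n C suc k) +_) (sym (*-distribˡ-+ (suc n) (n C k) _))) ⟩
  suc n C suc k + suc n * (n C k + n C suc k)
    ≡⟨ cong (λ z → suc n C suc k + suc n * z) (nCk+nC[k+1]≡[n+1]C[k+1] n k) ⟩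
  (2 + n) * (suc n C suc k) ∎

-- By symmetry C(2n + 2, n + 1) is twice C(2n + 1, n + 1), which absorption reduces to C(2n, n). The
-- right side is left unmerged because it is the coefficient form of a differential equation, with n
-- as the derivation.
centralBinomial-suc : ∀ n → suc n * centralBinomial (suc n) ≡ 4 * (n * centralBinomial n) + 2 * centralBinomial n
centralBinomial-suc n = begin
  suc n * ((suc n + suc n) C suc n)
    ≡⟨ cong (λ m → suc n * (m C suc n)) (cong suc (+-suc n n)) ⟩
  suc n * ((2 + (n + n)) C suc n)
    ≡⟨ cong (suc n *_) (nCk+nC[k+1]≡[n+1]C[k+1] (suc (n + n)) n) ⟨
  suc n * (suc (n + n) C n + suc (n + n) C suc n)
    ≡⟨ cong (λ z → suc n * (z + suc (n + n) C suc n)) symmetric ⟩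
  suc n * (suc (n + n) C suc n + suc (n + n) C suc n)
    ≡⟨ *-distribˡ-+ (suc n) (suc (n + n) C suc n) _ ⟩
  suc n * (suc (n + n) C suc n) + suc n * (suc (n + n) C suc n)
    ≡⟨ cong (λ z → z + z) (C-absorption (n + n) n) ⟩
  suc (n + n) * c + suc (n + n) * c
    ≡⟨ lemma n c ⟩
  4 * (n * c) + 2 * c ∎
  where
  c : ℕ
  c = centralBinomial n
  lemma : ∀ n c → suc (n + n) * c + suc (n + n) * c ≡ 4 * (n * c) + 2 * c
  lemma = ℕ-Solver.solve-∀
  symmetric : suc (n + n) C n ≡ suc (n + n) C suc n
  symmetric = trans (nCk≡nC[n∸k] {n} {suc (n + n)} (m≤n⇒m≤1+n (m≤m+n n n)))
    (cong ((suc (n + n)) C_) (trans (cong (_∸ n) (sym (+-suc n n))) (m+n∸m≡n n (suc n))))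

open import Data.Integer using (ℤ; +_)

-- The square of the central binomial series

module _ where
  open PowerSeries ℤ.+-*-commutativeRing

  -- The derivation t d/dt.
  θ : Series → Series
  θ f n = + n ℤ.* f n

  -- The Leibniz rule. Shifting the index turns `θ` into `θ` plus the identity; the extra copy of
  -- the tail of `f` accounts for the step from n to n + 1.
  θ-⊛ : ∀ f g n → θ (f ⊛ g) n ≡ (θ f ⊛ g) n ℤ.+ (f ⊛ θ g) n
  θ-⊛ f g zero    = lemma (f 0) (g 0)
    where
    lemma : ∀ a b → + 0 ℤ.* (a ℤ.* b) ≡ + 0 ℤ.* a ℤ.* b ℤ.+ a ℤ.* (+ 0 ℤ.* b)
    lemma = ℤ-Solver.solve-∀
  θ-⊛ f g (suc n) = begin
    + suc n ℤ.* (f 0 ℤ.* g (suc n) ℤ.+ (f′ ⊛ g) n)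
      ≡⟨ expand (+ n) (f 0) (g (suc n)) ((f′ ⊛ g) n) ⟩
    f 0 ℤ.* (+ suc n ℤ.* g (suc n)) ℤ.+ (f′ ⊛ g) n ℤ.+ θ (f′ ⊛ g) n
      ≡⟨ cong (λ z → f 0 ℤ.* (+ suc n ℤ.* g (suc n)) ℤ.+ (f′ ⊛ g) n ℤ.+ z) (θ-⊛ f′ g n) ⟩
    f 0 ℤ.* (+ suc n ℤ.* g (suc n)) ℤ.+ (f′ ⊛ g) n ℤ.+ ((θ f′ ⊛ g) n ℤ.+ (f′ ⊛ θ g) n)
      ≡⟨ collect (f 0) (g (suc n)) (+ suc n ℤ.* g (suc n)) ((f′ ⊛ g) n) ((θ f′ ⊛ g) n) ((f′ ⊛ θ g) n) ⟩
    (+ 0 ℤ.* f 0 ℤ.* g (suc n) ℤ.+ ((f′ ⊛ g) n ℤ.+ (θ f′ ⊛ g) n)) ℤ.+ (f ⊛ θ g) (suc n)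
      ≡⟨ cong (λ z → (+ 0 ℤ.* f 0 ℤ.* g (suc n) ℤ.+ z) ℤ.+ (f ⊛ θ g) (suc n)) (⊛-distribʳ g f′ (θ f′) n) ⟨
    (+ 0 ℤ.* f 0 ℤ.* g (suc n) ℤ.+ ((f′ ⊕ θ f′) ⊛ g) n) ℤ.+ (f ⊛ θ g) (suc n)
      ≡⟨ cong (λ z → (+ 0 ℤ.* f 0 ℤ.* g (suc n) ℤ.+ z) ℤ.+ (f ⊛ θ g) (suc n)) (⊛-cong tail (λ _ → refl) n) ⟩
    (θ f ⊛ g) (suc n) ℤ.+ (f ⊛ θ g) (suc n) ∎
    where
    f′ : Series
    f′ = f ∘ suc
    tail : f′ ⊕ θ f′ ≋ θ f ∘ suc
    tail n = sym (ℤ.suc-* (+ n) (f′ n))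
    expand : ∀ n a b c → (+ 1 ℤ.+ n) ℤ.* (a ℤ.* b ℤ.+ c) ≡ a ℤ.* ((+ 1 ℤ.+ n) ℤ.* b) ℤ.+ c ℤ.+ n ℤ.* c
    expand = ℤ-Solver.solve-∀
    collect : ∀ a b b′ c d e → a ℤ.* b′ ℤ.+ c ℤ.+ (d ℤ.+ e) ≡ (+ 0 ℤ.* a ℤ.* b ℤ.+ (c ℤ.+ d)) ℤ.+ (a ℤ.* b′ ℤ.+ e)
    collect = ℤ-Solver.solve-∀

  centralBinomials : Series
  centralBinomials n = + centralBinomial n

  𝒸 𝒹 ℯ : Series
  𝒸 = centralBinomials
  𝒹 = 𝒸 ⊛ 𝒸
  ℯ = θ 𝒸 ⊛ 𝒸

  -- (1 − 4t) θ𝒸 = 2t 𝒸 gives (1 − 4t) θ𝒹 = 4t 𝒹, the differential equation of 1/(1 − 4t).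
  centralBinomials-⊛-suc : ∀ n → 𝒹 (suc n) ≡ + 4 ℤ.* 𝒹 n
  centralBinomials-⊛-suc n = ℤ.*-cancelˡ-≡ (+ suc n) (𝒹 (suc n)) (+ 4 ℤ.* 𝒹 n) (begin
    θ 𝒹 (suc n)                                   ≡⟨ θ𝒹 (suc n) ⟩
    ℯ (suc n) ℤ.+ ℯ (suc n)                       ≡⟨ cong (λ z → z ℤ.+ z) ℯ-suc ⟩
    (+ 4 ℤ.* ℯ n ℤ.+ + 2 ℤ.* 𝒹 n) ℤ.+ (+ 4 ℤ.* ℯ n ℤ.+ + 2 ℤ.* 𝒹 n)
                                                  ≡⟨ regroup (ℯ n) (𝒹 n) ⟩
    + 4 ℤ.* (ℯ n ℤ.+ ℯ n) ℤ.+ + 4 ℤ.* 𝒹 n         ≡⟨ cong (λ z → + 4 ℤ.* z ℤ.+ + 4 ℤ.* 𝒹 n) (θ𝒹 n) ⟨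
    + 4 ℤ.* (+ n ℤ.* 𝒹 n) ℤ.+ + 4 ℤ.* 𝒹 n         ≡⟨ factor (+ n) (𝒹 n) ⟩
    + suc n ℤ.* (+ 4 ℤ.* 𝒹 n)                     ∎)
    where
    θ𝒹 : ∀ n → θ 𝒹 n ≡ ℯ n ℤ.+ ℯ n
    θ𝒹 n = trans (θ-⊛ 𝒸 𝒸 n) (cong (λ z → ℯ n ℤ.+ z) (⊛-comm 𝒸 (θ 𝒸) n))
    regroup : ∀ e d → (+ 4 ℤ.* e ℤ.+ + 2 ℤ.* d) ℤ.+ (+ 4 ℤ.* e ℤ.+ + 2 ℤ.* d) ≡ + 4 ℤ.* (e ℤ.+ e) ℤ.+ + 4 ℤ.* d
    regroup = ℤ-Solver.solve-∀
    factor : ∀ n d → + 4 ℤ.* (n ℤ.* d) ℤ.+ + 4 ℤ.* d ≡ (+ 1 ℤ.+ n) ℤ.* (+ 4 ℤ.* d)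
    factor = ℤ-Solver.solve-∀
    θ𝒸-suc : ∀ n → θ 𝒸 (suc n) ≡ + 4 ℤ.* θ 𝒸 n ℤ.+ + 2 ℤ.* 𝒸 n
    θ𝒸-suc n = begin
      + suc n ℤ.* + centralBinomial (suc n)
        ≡⟨ ℤ.pos-* (suc n) (centralBinomial (suc n)) ⟨
      + (suc n * centralBinomial (suc n))
        ≡⟨ cong +_ (centralBinomial-suc n) ⟩
      + (4 * (n * centralBinomial n)) ℤ.+ + (2 * centralBinomial n)
        ≡⟨ cong₂ ℤ._+_ (trans (ℤ.pos-* 4 (n * centralBinomial n)) (cong (+ 4 ℤ.*_) (ℤ.pos-* n (centralBinomial n))))
                       (ℤ.pos-* 2 (centralBinomial n)) ⟩
      + 4 ℤ.* θ 𝒸 n ℤ.+ + 2 ℤ.* 𝒸 n ∎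
    ℯ-suc : ℯ (suc n) ≡ + 4 ℤ.* ℯ n ℤ.+ + 2 ℤ.* 𝒹 n
    ℯ-suc = begin
      + 0 ℤ.* 𝒸 (suc n) ℤ.+ ((θ 𝒸 ∘ suc) ⊛ 𝒸) n
        ≡⟨ ℤ.+-identityˡ _ ⟩
      ((θ 𝒸 ∘ suc) ⊛ 𝒸) n
        ≡⟨ ⊛-cong θ𝒸-suc (λ _ → refl) n ⟩
      (((λ i → + 4 ℤ.* θ 𝒸 i) ⊕ (λ i → + 2 ℤ.* 𝒸 i)) ⊛ 𝒸) n
        ≡⟨ ⊛-distribʳ 𝒸 _ _ n ⟩
      ((λ i → + 4 ℤ.* θ 𝒸 i) ⊛ 𝒸) n ℤ.+ ((λ i → + 2 ℤ.* 𝒸 i) ⊛ 𝒸) n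
        ≡⟨ cong₂ ℤ._+_ (scale-⊛ (+ 4) (θ 𝒸) 𝒸 n) (scale-⊛ (+ 2) 𝒸 𝒸 n) ⟩
      + 4 ℤ.* ℯ n ℤ.+ + 2 ℤ.* 𝒹 n ∎

-- Series in two variables

-- Series in x whose coefficients are series in y: `X.Series` unfolds to `PS` and its equality to
-- `_≈ₚ_`, so only the products have to be compared.
module Y = PowerSeries ℤ.+-*-commutativeRing
module X = PowerSeries Y.commutativeRing

sumℤ-upTo-suc : ∀ (F : ℕ → ℤ) n → sumℤ (map F (upTo (suc n))) ≡ F 0 ℤ.+ sumℤ (map (F ∘ suc) (upTo n))
sumℤ-upTo-suc F n = cong (λ l → F 0 ℤ.+ sumℤ l) (trans (map-applyUpTo suc F n) (sym (map-upTo (F ∘ suc) n)))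

sumℤ-⊛₁ : ∀ u v j → sumℤ (map (λ b → u b ℤ.* v (j ∸ b)) (upTo (suc j))) ≡ (u Y.⊛ v) j
sumℤ-⊛₁ u v zero    = ℤ.+-identityʳ (u 0 ℤ.* v 0)
sumℤ-⊛₁ u v (suc j) = trans (sumℤ-upTo-suc (λ b → u b ℤ.* v (suc j ∸ b)) (suc j))
  (cong (λ z → u 0 ℤ.* v (suc j) ℤ.+ z) (sumℤ-⊛₁ (u ∘ suc) v j))

sumℤ-⊛₂ : ∀ (f g : PS) i j → sumℤ (map (λ a → (f a Y.⊛ g (i ∸ a)) j) (upTo (suc i))) ≡ (f X.⊛ g) i j
sumℤ-⊛₂ f g zero    j = ℤ.+-identityʳ ((f 0 Y.⊛ g 0) j)
sumℤ-⊛₂ f g (suc i) j = trans (sumℤ-upTo-suc (λ a → (f a Y.⊛ g (suc i ∸ a)) j) (suc i))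
  (cong (λ z → (f 0 Y.⊛ g (suc i)) j ℤ.+ z) (sumℤ-⊛₂ (f ∘ suc) g i j))

*ₚ≈⊛ : ∀ f g → (f *ₚ g) ≈ₚ (f X.⊛ g)
*ₚ≈⊛ f g i j = trans
  (cong sumℤ (map-cong (λ a → sumℤ-⊛₁ (f a) (g (i ∸ a)) j) (upTo (suc i))))
  (sumℤ-⊛₂ f g i j)

mono-const : ∀ c → mono c 0 0 ≈ₚ X.const (Y.const c)
mono-const c zero    zero    = refl
mono-const c zero    (suc j) = refl
mono-const c (suc i) j       = refl

PS-ring : CommutativeRing _ _
PS-ring = withMultiplication X.commutativeRing _*ₚ_ oneₚ *ₚ≈⊛ (mono-const (+ 1))

module PS-ring = CommutativeRing PS-ring

-- Multiplication by x^m y^n, by cases on the indices so that coefficients reduce by computation.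
shiftBy : ℕ → ℕ → PS → PS
shiftBy m       (suc n) f i       zero    = + 0
shiftBy m       (suc n) f i       (suc j) = shiftBy m n f i j
shiftBy (suc m) zero    f zero    j       = + 0
shiftBy (suc m) zero    f (suc i) j       = shiftBy m zero f i j
shiftBy zero    zero    f i       j       = f i j

scale : ℤ → PS → PS
scale c f i j = c ℤ.* f i j

mono-⊛ : ∀ c m n f → (mono c m n X.⊛ f) ≈ₚ shiftBy m n (scale c f)
mono-⊛ c zero    zero    f i j = begin
  (mono c 0 0 X.⊛ f) i j               ≡⟨ X.⊛-cong (mono-const c) (λ _ _ → refl) i j ⟩
  (X.const (Y.const c) X.⊛ f) i j      ≡⟨ X.const-⊛ (Y.const c) f i j ⟩
  (Y.const c Y.⊛ f i) j                ≡⟨ Y.const-⊛ c (f i) j ⟩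
  c ℤ.* f i j                          ∎
mono-⊛ c (suc m) zero    f i j = begin
  (mono c (suc m) 0 X.⊛ f) i j         ≡⟨ X.⊛-cong mono-suc (λ _ _ → refl) i j ⟩
  (X.shift (mono c m 0) X.⊛ f) i j     ≡⟨ X.shift-⊛ (mono c m 0) f i j ⟩
  X.shift (mono c m 0 X.⊛ f) i j       ≡⟨ shifted i ⟩
  shiftBy (suc m) 0 (scale c f) i j    ∎
  where
  mono-suc : mono c (suc m) 0 ≈ₚ X.shift (mono c m 0)
  mono-suc zero    j = refl
  mono-suc (suc i) j = refl
  shifted : ∀ i → X.shift (mono c m 0 X.⊛ f) i j ≡ shiftBy (suc m) 0 (scale c f) i j
  shifted zero    = refl
  shifted (suc i) = mono-⊛ c m 0 f i j
mono-⊛ c m       (suc n) f i j = begin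
  (mono c m (suc n) X.⊛ f) i j         ≡⟨ X.⊛-cong mono-suc (λ _ _ → refl) i j ⟩
  ((Y.shift ∘ mono c m n) X.⊛ f) i j   ≡⟨ shift-⊛ (mono c m n) i j ⟩
  Y.shift ((mono c m n X.⊛ f) i) j     ≡⟨ shifted j ⟩
  shiftBy m (suc n) (scale c f) i j    ∎
  where
  mono-suc : mono c m (suc n) ≈ₚ (Y.shift ∘ mono c m n)
  mono-suc i zero    = cong (λ b → if b then c else + 0) (∧-zeroʳ (i ≡ᵇ m))
  mono-suc i (suc j) = refl
  shift-+ : ∀ u v → (Y.shift u Y.⊕ Y.shift v) Y.≋ Y.shift (u Y.⊕ v)
  shift-+ u v zero    = refl
  shift-+ u v (suc j) = refl
  shift-⊛ : ∀ g → ((Y.shift ∘ g) X.⊛ f) ≈ₚ (Y.shift ∘ (g X.⊛ f))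
  shift-⊛ g zero    j = Y.shift-⊛ (g 0) (f 0) j
  shift-⊛ g (suc i) j = trans (cong₂ ℤ._+_ (Y.shift-⊛ (g 0) (f (suc i)) j) (shift-⊛ (g ∘ suc) i j))
                              (shift-+ (g 0 Y.⊛ f (suc i)) (((g ∘ suc) X.⊛ f) i) j)
  shifted : ∀ j → Y.shift ((mono c m n X.⊛ f) i) j ≡ shiftBy m (suc n) (scale c f) i j
  shifted zero    = refl
  shifted (suc j) = mono-⊛ c m n f i j

shiftBy-cong : ∀ m n {f g} → f ≈ₚ g → shiftBy m n f ≈ₚ shiftBy m n g
shiftBy-cong m       (suc n) f≈g i       zero    = refl
shiftBy-cong m       (suc n) f≈g i       (suc j) = shiftBy-cong m n f≈g i j
shiftBy-cong (suc m) zero    f≈g zero    j       = refl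
shiftBy-cong (suc m) zero    f≈g (suc i) j       = shiftBy-cong m zero f≈g i j
shiftBy-cong zero    zero    f≈g i       j       = f≈g i j

mono-*ₚ : ∀ c m n f → (mono c m n *ₚ f) ≈ₚ shiftBy m n (scale c f)
mono-*ₚ c m n f i j = trans (*ₚ≈⊛ (mono c m n) f i j) (mono-⊛ c m n f i j)

mono₁-*ₚ : ∀ m n f → (mono (+ 1) m n *ₚ f) ≈ₚ shiftBy m n f
mono₁-*ₚ m n f i j = trans (mono-*ₚ (+ 1) m n f i j) (shiftBy-cong m n (λ i j → ℤ.*-identityˡ (f i j)) i j)

mono₁-*ₚ-mono : ∀ m n c k l → (mono (+ 1) m n *ₚ mono c k l) ≈ₚ mono c (m + k) (n + l)
mono₁-*ₚ-mono m n c k l i j = trans (mono₁-*ₚ m n (mono c k l) i j) (shifted m n i j)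
  where
  shifted : ∀ m n → shiftBy m n (mono c k l) ≈ₚ mono c (m + k) (n + l)
  shifted m       (suc n) i       zero    = sym (cong (λ b → if b then c else + 0) (∧-zeroʳ (i ≡ᵇ m + k)))
  shifted m       (suc n) i       (suc j) = shifted m n i j
  shifted (suc m) zero    zero    j       = refl
  shifted (suc m) zero    (suc i) j       = shifted m zero i j
  shifted zero    zero    i       j       = refl

-- The expansion of 1/(1 - 2xy).
diagonal : PS
diagonal i j = if i ≡ᵇ j then + (2 ^ i) else + 0

Wₚ Lₚ Bₚ : PS
Wₚ = mono (+ 1) 1 1
Lₚ = oneₚ -ₚ mono (+ 2) 1 1
Bₚ i = Y.const (centralBinomials i)

-- x³y³ / (1 − 2xy), the contribution of the boundary values 2 ^ l.
shifted-diagonal : PS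
shifted-diagonal = shiftBy 3 3 diagonal

shifted-diagonal-off : ∀ i j → (i ≡ᵇ j) ≡ false → shifted-diagonal i j ≡ + 0
shifted-diagonal-off i                   zero                _ = refl
shifted-diagonal-off i                   (suc zero)          _ = refl
shifted-diagonal-off i                   (suc (suc zero))    _ = refl
shifted-diagonal-off zero                (suc (suc (suc j))) _ = refl
shifted-diagonal-off (suc zero)          (suc (suc (suc j))) _ = refl
shifted-diagonal-off (suc (suc zero))    (suc (suc (suc j))) _ = refl
shifted-diagonal-off (suc (suc (suc i))) (suc (suc (suc j))) e rewrite e = refl

shifted-diagonal-below : ∀ {i j} → j < i → shifted-diagonal i j ≡ + 0
shifted-diagonal-below {i} {j} j<i = shifted-diagonal-off i j (trans (≡ᵇ-sym i j) (≡ᵇ-false j<i))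

shifted-diagonal-above : ∀ {i j} → i < j → shifted-diagonal i j ≡ + 0
shifted-diagonal-above {i} {j} i<j = shifted-diagonal-off i j (≡ᵇ-false i<j)

-- The kernel equation

h-at : ∀ n k r → n ≡ k + r → h (suc n) (suc k) ≡ completions k r
h-at n k r refl = h-inside k r

-- For k < m this is the recurrence of `completions`. At k = m and k = m + 1 that recurrence does
-- not apply; the values are powers of 2, and the diagonal series supplies the difference, first at
-- x³ y³. For larger k everything vanishes.
h-recurrence : ∀ m k → + h (2 + m) (2 + k) ℤ.+ + h (1 + m) k ℤ.+ shifted-diagonal (2 + m) (1 + k) ≡
                       + h (2 + m) (1 + k) ℤ.+ shifted-diagonal (2 + m) (2 + k)
h-recurrence m k with compare k m
... | less k r
  rewrite shifted-diagonal-below {3 + (k + r)} {1 + k} (s≤s (m≤n⇒m≤1+n (s≤s (m≤m+n k r))))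
        | shifted-diagonal-below {3 + (k + r)} {2 + k} (s≤s (s≤s (s≤s (m≤m+n k r))))
        | h-at (2 + (k + r)) (suc k) (suc r) (cong suc (sym (+-suc k r)))
        | h-at (2 + (k + r)) k (2 + r) (sym (trans (+-suc k (suc r)) (cong suc (+-suc k r))))
  = cong (λ z → + z ℤ.+ + 0) (interior k)
  where
  interior : ∀ k → completions (suc k) (suc r) + h (2 + (k + r)) k ≡ completions k (2 + r)
  interior zero    = trans (cong (λ z → completions 1 (suc r) + z) (h-zero (2 + r))) (+-identityʳ _)
  interior (suc k) = trans
    (cong (λ z → completions (2 + k) (suc r) + z) (h-at (2 + (k + r)) k (2 + r) (sym (trans (+-suc k (suc r)) (cong suc (+-suc k r))))))
    (+-comm (completions (2 + k) (suc r)) _)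
... | equal m
  rewrite shifted-diagonal-below {2 + m} {1 + m} ≤-refl
        | h-at (1 + m) (1 + m) 0 (sym (+-identityʳ (1 + m)))
        | h-at (1 + m) m 1 (+-comm 1 m)
  = edge m
  where
  edge : ∀ m → + (2 ^ m) ℤ.+ + h (1 + m) m ℤ.+ + 0 ≡ + (2 ^ m) ℤ.+ shifted-diagonal (2 + m) (2 + m)
  -- At `m = 0` both `h 1 0` and the diagonal entry vanish; later both are the same power of 2.
  edge zero    = refl
  edge (suc m) rewrite h-at (1 + m) m 1 (+-comm 1 m) | ≡ᵇ-refl m = ℤ.+-identityʳ _
... | greater m zero
  rewrite +-identityʳ m | shifted-diagonal-above {2 + m} {3 + m} ≤-refl
        | h-above (2 + m) (3 + m) ≤-refl
        | h-at m m 0 (sym (+-identityʳ m))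
        | h-at (1 + m) (1 + m) 0 (sym (+-identityʳ (1 + m)))
  = edge m
  where
  edge : ∀ m → + 0 ℤ.+ + completions m 0 ℤ.+ shifted-diagonal (2 + m) (2 + m) ≡ + (2 ^ m) ℤ.+ + 0
  -- Here `completions 0 0 = 1` stands alone; later two equal powers of 2 add up to the next one.
  edge zero    = refl
  edge (suc m) rewrite ≡ᵇ-refl m =
    trans (cong (λ z → + (2 ^ m + z)) (sym (+-identityʳ (2 ^ m)))) (sym (ℤ.+-identityʳ (+ (2 ^ suc m))))
... | greater m (suc r)
  rewrite shifted-diagonal-above {2 + m} {2 + (m + suc r)} (s≤s (s≤s (m<m+n m z<s)))
        | shifted-diagonal-above {2 + m} {3 + (m + suc r)} (s≤s (s≤s (m≤n⇒m≤1+n (m<m+n m z<s))))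
        | h-above (2 + m) (3 + (m + suc r)) (s≤s (s≤s (m≤n⇒m≤1+n (m<m+n m z<s))))
        | h-above (1 + m) (1 + (m + suc r)) (s≤s (m<m+n m z<s))
        | h-above (2 + m) (2 + (m + suc r)) (s≤s (s≤s (m<m+n m z<s)))
  = refl

open RingIdentities PS-ring
open RingProperties PS-ring.ring using ([y-z]x≈yx-zx)
open CommutativeSemigroupProperties PS-ring.*-commutativeSemigroup using () renaming (interchange to *ₚ-interchange)

H-kernel-coefficients : ∀ i j →
  H i j ℤ.+ shiftBy 1 2 H i j ℤ.+ shiftBy 1 1 yₚ i j ℤ.+ shiftBy 0 1 shifted-diagonal i j ≡
  shiftBy 0 1 H i j ℤ.+ Wₚ i j ℤ.+ shiftBy 1 1 (shiftBy 1 0 Bₚ) i j ℤ.+ shifted-diagonal i j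
-- The splits reach four in y because the diagonal, already shifted by 3, is shifted once more.
H-kernel-coefficients zero zero                         = refl
H-kernel-coefficients zero (suc zero)                   = refl
H-kernel-coefficients zero (suc (suc zero))             = refl
H-kernel-coefficients zero (suc (suc (suc zero)))       = refl
H-kernel-coefficients zero (suc (suc (suc (suc j))))    = refl
H-kernel-coefficients (suc i) zero
  rewrite h-zero (suc i) | ∧-zeroʳ (i ≡ᵇ 0) = refl
H-kernel-coefficients (suc zero) (suc zero)             = refl
H-kernel-coefficients (suc zero) (suc (suc zero))       = refl
H-kernel-coefficients (suc zero) (suc (suc (suc j)))
  rewrite h-above 1 (3 + j) (s≤s z<s) | h-above 1 (2 + j) (s≤s z<s) = at j
  where
  at : ∀ j → + 0 ℤ.+ + 0 ℤ.+ + 0 ℤ.+ shifted-diagonal 1 (2 + j) ≡ + 0 ℤ.+ + 0 ℤ.+ + 0 ℤ.+ shifted-diagonal 1 (3 + j)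
  at zero    = refl
  at (suc j) = refl
-- First value 1: `completions 0 (suc m)` is the central binomial coefficient at x^m in `Bₚ`, moved
-- by the factor x² y.
H-kernel-coefficients (suc (suc m)) (suc zero)
  rewrite h-at (1 + m) 0 (1 + m) refl | completions-zero m | h-zero (2 + m) =
  cong +_ (trans (+-identityʳ _) (trans (+-identityʳ _) (trans (+-identityʳ _) (sym (+-identityʳ _)))))
H-kernel-coefficients (suc (suc m)) (suc (suc k)) = begin
  + h (2 + m) (2 + k) ℤ.+ + h (1 + m) k ℤ.+ + 0 ℤ.+ shifted-diagonal (2 + m) (1 + k)
    ≡⟨ cong (λ z → z ℤ.+ shifted-diagonal (2 + m) (1 + k)) (ℤ.+-identityʳ (+ h (2 + m) (2 + k) ℤ.+ + h (1 + m) k)) ⟩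
  + h (2 + m) (2 + k) ℤ.+ + h (1 + m) k ℤ.+ shifted-diagonal (2 + m) (1 + k)
    ≡⟨ h-recurrence m k ⟩
  + h (2 + m) (1 + k) ℤ.+ shifted-diagonal (2 + m) (2 + k)
    ≡⟨ cong (λ z → z ℤ.+ shifted-diagonal (2 + m) (2 + k))
         (trans (ℤ.+-identityʳ (+ h (2 + m) (1 + k) ℤ.+ + 0)) (ℤ.+-identityʳ (+ h (2 + m) (1 + k)))) ⟨
  + h (2 + m) (1 + k) ℤ.+ + 0 ℤ.+ + 0 ℤ.+ shifted-diagonal (2 + m) (2 + k) ∎

H-kernel : (H *ₚ (oneₚ -ₚ yₚ +ₚ mono (+ 1) 1 2)) ≈ₚ
           (Wₚ *ₚ (oneₚ -ₚ yₚ) +ₚ Wₚ *ₚ (xₚ *ₚ Bₚ) +ₚ shifted-diagonal *ₚ (oneₚ -ₚ yₚ))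
H-kernel = kernel-relation H (mono (+ 1) 1 2) Wₚ yₚ (Wₚ *ₚ (xₚ *ₚ Bₚ)) shifted-diagonal λ i j → begin
  H i j ℤ.+ (mono (+ 1) 1 2 *ₚ H) i j ℤ.+ (Wₚ *ₚ yₚ) i j ℤ.+ (shifted-diagonal *ₚ yₚ) i j
    ≡⟨ cong₂ (λ u v → u ℤ.+ v) (cong₂ (λ u v → H i j ℤ.+ u ℤ.+ v) (mono₁-*ₚ 1 2 H i j) (mono₁-*ₚ 1 1 yₚ i j))
         (trans (PS-ring.*-comm shifted-diagonal yₚ i j) (mono₁-*ₚ 0 1 shifted-diagonal i j)) ⟩
  H i j ℤ.+ shiftBy 1 2 H i j ℤ.+ shiftBy 1 1 yₚ i j ℤ.+ shiftBy 0 1 shifted-diagonal i j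
    ≡⟨ H-kernel-coefficients i j ⟩
  shiftBy 0 1 H i j ℤ.+ Wₚ i j ℤ.+ shiftBy 1 1 (shiftBy 1 0 Bₚ) i j ℤ.+ shifted-diagonal i j
    ≡⟨ cong₂ (λ u v → u ℤ.+ Wₚ i j ℤ.+ v ℤ.+ shifted-diagonal i j) (mono₁-*ₚ 0 1 H i j)
         (trans (mono₁-*ₚ 1 1 (xₚ *ₚ Bₚ) i j) (shiftBy-cong 1 1 (mono₁-*ₚ 1 0 Bₚ) i j)) ⟨
  (yₚ *ₚ H) i j ℤ.+ Wₚ i j ℤ.+ (Wₚ *ₚ (xₚ *ₚ Bₚ)) i j ℤ.+ shifted-diagonal i j ∎

-- Clearing the denominators

diagonal-inverse : (Lₚ *ₚ diagonal) ≈ₚ oneₚ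
diagonal-inverse i j = begin
  (Lₚ *ₚ diagonal) i j
    ≡⟨ [y-z]x≈yx-zx diagonal oneₚ (mono (+ 2) 1 1) i j ⟩
  (oneₚ *ₚ diagonal) i j ℤ.- (mono (+ 2) 1 1 *ₚ diagonal) i j
    ≡⟨ cong₂ ℤ._-_ (PS-ring.*-identityˡ diagonal i j) (mono-*ₚ (+ 2) 1 1 diagonal i j) ⟩
  diagonal i j ℤ.- shiftBy 1 1 (scale (+ 2) diagonal) i j
    ≡⟨ coefficient i j ⟩
  oneₚ i j ∎
  where
  coefficient : ∀ i j → diagonal i j ℤ.- shiftBy 1 1 (scale (+ 2) diagonal) i j ≡ oneₚ i j
  coefficient zero    zero    = refl
  coefficient zero    (suc j) = refl
  coefficient (suc i) zero    = refl
  coefficient (suc i) (suc j) with i ≡ᵇ j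
  ... | false = refl
  ... | true  = trans (cong (λ z → + (2 ^ suc i) ℤ.- z) (sym (ℤ.pos-* 2 (2 ^ i)))) (ℤ.+-inverseʳ (+ (2 ^ suc i)))

shifted-diagonal-*-L : (shifted-diagonal *ₚ Lₚ) ≈ₚ (Wₚ *ₚ (Wₚ *ₚ Wₚ))
shifted-diagonal-*-L i j = begin
  (shifted-diagonal *ₚ Lₚ) i j
    ≡⟨ PS-ring.*-congʳ {Lₚ} {mono (+ 1) 3 3 *ₚ diagonal} {shifted-diagonal} (mono₁-*ₚ 3 3 diagonal) i j ⟨
  (mono (+ 1) 3 3 *ₚ diagonal *ₚ Lₚ) i j
    ≡⟨ PS-ring.*-assoc (mono (+ 1) 3 3) diagonal Lₚ i j ⟩
  (mono (+ 1) 3 3 *ₚ (diagonal *ₚ Lₚ)) i j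
    ≡⟨ PS-ring.*-congˡ {mono (+ 1) 3 3} {diagonal *ₚ Lₚ} {oneₚ}
         (λ i j → trans (PS-ring.*-comm diagonal Lₚ i j) (diagonal-inverse i j)) i j ⟩
  (mono (+ 1) 3 3 *ₚ oneₚ) i j
    ≡⟨ mono₁-*ₚ-mono 3 3 (+ 1) 0 0 i j ⟩
  mono (+ 1) 3 3 i j
    ≡⟨ mono₁-*ₚ-mono 1 1 (+ 1) 2 2 i j ⟨
  (Wₚ *ₚ mono (+ 1) 2 2) i j
    ≡⟨ PS-ring.*-congˡ {Wₚ} {Wₚ *ₚ Wₚ} {mono (+ 1) 2 2} (mono₁-*ₚ-mono 1 1 (+ 1) 1 1) i j ⟨
  (Wₚ *ₚ (Wₚ *ₚ Wₚ)) i j ∎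

square-xy-1 : ((Wₚ -ₚ oneₚ) *ₚ (Wₚ -ₚ oneₚ)) ≈ₚ (Lₚ +ₚ Wₚ *ₚ Wₚ)
square-xy-1 i j = trans (square-of-difference Wₚ i j)
  (cong (λ z → (oneₚ i j ℤ.- z) ℤ.+ (Wₚ *ₚ Wₚ) i j) (double i j))
  where
  double : (Wₚ +ₚ Wₚ) ≈ₚ mono (+ 2) 1 1
  double i j with (i ≡ᵇ 1) ∧ (j ≡ᵇ 1)
  ... | true  = refl
  ... | false = refl

-- Series in x alone multiply as in one variable, which carries the square of the central binomial
-- series over to `Bₚ`.
const-*ₚ : ∀ f g → ((Y.const ∘ f) *ₚ (Y.const ∘ g)) ≈ₚ (Y.const ∘ (f Y.⊛ g))
const-*ₚ f g i j = trans (*ₚ≈⊛ (Y.const ∘ f) (Y.const ∘ g) i j) (convolve f i j)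
  where
  const-* : ∀ a b j → (Y.const a Y.⊛ Y.const b) j ≡ Y.const (a ℤ.* b) j
  const-* a b zero    = refl
  const-* a b (suc j) = trans (Y.const-⊛ a (Y.const b) (suc j)) (ℤ.*-zeroʳ a)
  const-+ : ∀ a b j → Y.const a j ℤ.+ Y.const b j ≡ Y.const (a ℤ.+ b) j
  const-+ a b zero    = refl
  const-+ a b (suc j) = refl
  convolve : ∀ f i j → ((Y.const ∘ f) X.⊛ (Y.const ∘ g)) i j ≡ Y.const ((f Y.⊛ g) i) j
  convolve f zero    j = const-* (f 0) (g 0) j
  convolve f (suc i) j = trans (cong₂ ℤ._+_ (const-* (f 0) (g (suc i)) j) (convolve (f ∘ suc) i j))
                               (const-+ (f 0 ℤ.* g (suc i)) _ j)

binomial-square-inverse : ((oneₚ -ₚ mono (+ 4) 1 0) *ₚ (Bₚ *ₚ Bₚ)) ≈ₚ oneₚ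
binomial-square-inverse i j = begin
  ((oneₚ -ₚ mono (+ 4) 1 0) *ₚ (Bₚ *ₚ Bₚ)) i j
    ≡⟨ PS-ring.*-congˡ {oneₚ -ₚ mono (+ 4) 1 0} {Bₚ *ₚ Bₚ} {D} (const-*ₚ centralBinomials centralBinomials) i j ⟩
  ((oneₚ -ₚ mono (+ 4) 1 0) *ₚ D) i j
    ≡⟨ [y-z]x≈yx-zx D oneₚ (mono (+ 4) 1 0) i j ⟩
  (oneₚ *ₚ D) i j ℤ.- (mono (+ 4) 1 0 *ₚ D) i j
    ≡⟨ cong₂ ℤ._-_ (PS-ring.*-identityˡ D i j) (mono-*ₚ (+ 4) 1 0 D i j) ⟩
  D i j ℤ.- shiftBy 1 0 (scale (+ 4) D) i j
    ≡⟨ coefficient i j ⟩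
  oneₚ i j ∎
  where
  D : PS
  D = Y.const ∘ (centralBinomials Y.⊛ centralBinomials)
  coefficient : ∀ i j → D i j ℤ.- shiftBy 1 0 (scale (+ 4) D) i j ≡ oneₚ i j
  coefficient zero    zero    = refl
  coefficient zero    (suc j) = refl
  coefficient (suc i) zero    = trans
    (cong (λ z → z ℤ.- + 4 ℤ.* D i 0) (centralBinomials-⊛-suc i)) (ℤ.+-inverseʳ (+ 4 ℤ.* D i 0))
  coefficient (suc i) (suc j) = refl

module _ (s : PS) (s₀₀≡1 : s 0 0 ≡ + 1) (s²≈1-4x : (s *ₚ s) ≈ₚ (oneₚ -ₚ mono (+ 4) 1 0)) where

  -- Bs squares to 1 and has constant term 1; as 2 is not a zero divisor, Bs + 1 is regular, so Bs = 1.
  binomial-inverse : (Bₚ *ₚ s) ≈ₚ oneₚ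
  binomial-inverse i j = ℤ.i-j≡0⇒i≡j ((Bₚ *ₚ s) i j) (oneₚ i j)
    (X.regular {u +ₚ oneₚ} (Y.regular {(u +ₚ oneₚ) 0} 2-regular) (u -ₚ oneₚ)
      (λ i j → trans (sym (*ₚ≈⊛ (u -ₚ oneₚ) (u +ₚ oneₚ) i j)) (involution-factor u u²≈1 i j)) i j)
    where
    u : PS
    u = Bₚ *ₚ s
    2-regular : ∀ z → z ℤ.* (u 0 0 ℤ.+ + 1) ≡ + 0 → z ≡ + 0
    2-regular z e rewrite s₀₀≡1 = ℤ.*-cancelʳ-≡ z (+ 0) (+ 2) e
    u²≈1 : (u *ₚ u) ≈ₚ oneₚ
    u²≈1 i j = begin
      ((Bₚ *ₚ s) *ₚ (Bₚ *ₚ s)) i j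
        ≡⟨ *ₚ-interchange Bₚ s Bₚ s i j ⟩
      ((Bₚ *ₚ Bₚ) *ₚ (s *ₚ s)) i j
        ≡⟨ PS-ring.*-comm (Bₚ *ₚ Bₚ) (s *ₚ s) i j ⟩
      ((s *ₚ s) *ₚ (Bₚ *ₚ Bₚ)) i j
        ≡⟨ PS-ring.*-congʳ {Bₚ *ₚ Bₚ} {s *ₚ s} {oneₚ -ₚ mono (+ 4) 1 0} s²≈1-4x i j ⟩
      ((oneₚ -ₚ mono (+ 4) 1 0) *ₚ (Bₚ *ₚ Bₚ)) i j
        ≡⟨ binomial-square-inverse i j ⟩
      oneₚ i j ∎

theorem11 : (s : PS) → s 0 0 ≡ + 1 → (s *ₚ s) ≈ₚ (oneₚ -ₚ mono (+ 4) 1 0) →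
    (H *ₚ ((oneₚ -ₚ yₚ +ₚ mono (+ 1) 1 2) *ₚ (oneₚ -ₚ mono (+ 2) 1 1) *ₚ s))
    ≈ₚ (mono (+ 1) 1 1 *ₚ
    ((mono (+ 1) 1 1 -ₚ oneₚ) *ₚ (mono (+ 1) 1 1 -ₚ oneₚ) *ₚ (oneₚ -ₚ yₚ) *ₚ s
    +ₚ xₚ *ₚ (oneₚ -ₚ mono (+ 2) 1 1)))
theorem11 s s₀₀≡1 s²≈1-4x =
  multiply-out {H} {oneₚ -ₚ yₚ +ₚ mono (+ 1) 1 2} {Lₚ} {s} {Wₚ} {Wₚ -ₚ oneₚ} {oneₚ -ₚ yₚ} {xₚ} {Bₚ} {shifted-diagonal}
    H-kernel shifted-diagonal-*-L square-xy-1 (binomial-inverse s s₀₀≡1 s²≈1-4x)
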